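{- Let $s,t\ge 0$ and let $i_1<\cdots<i_s$ and $j_1<\cdots<j_t$ be fixed nonnegative integer constants, and for each $n$ let $$S_n=\{i_1<i_2<\cdots<i_s<n-j_t<\cdots<n-j_2<n-j_1\}.$$ Suppose $S_n$ is admissible, i.e. $\#P(S_n;n)\ne0$ for some $n$. Then there is a polynomial $p(n)$, integer-valued at all integers, such that $\#P(S_n;n)=p(n)\,2^{n-\#S_n-1}$ for every $n$ with $\#P(S_n;n)\neq0$, and $$\deg p(n)=\begin{cases}0 & \text{if } s=t=0,\\ i_s-1 & \text{if } s>0,\ t=0,\\ j_t & \text{if } s=0,\ t>0,\\ i_s+j_t-1 & \text{otherwise.}\end{cases}$$
   Context: For a permutation $\pi=a_1\ldots a_n$ of $\{1,\ldots,n\}$, an index $i$ is a peak if $a_{i-1}<a_i>a_{i+1}$. For a set $S$ of positive integers, $P(S;n)$ is the set of permutations of $\{1,\dots,n\}$ whose set of peaks is exactly $S$. -}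

module Defs where

open import Data.Nat as ℕ using (ℕ; zero; suc; _∸_; _<_)
import Data.Nat.Properties as ℕP
open import Data.Integer as ℤ using (ℤ)
open import Data.Rational as ℚ using (ℚ; 0ℚ)
open import Data.Fin as Fin using (Fin; toℕ; fromℕ)
open import Data.Vec as Vec using (Vec; []; _∷_)
open import Data.List as List using (List; []; _∷_; _++_; length; filter; concatMap; map)
import Data.List.Relation.Unary.Unique.DecPropositional as UDec
open import Data.List.Relation.Binary.Subset.DecPropositional ℕP._≟_ using (_⊆?_)
open import Data.Bool using (Bool; if_then_else_; _∧_)
open import Data.Product using (Σ; ∃-syntax; _×_; _,_)
open import Relation.Nullary using (Dec; _×-dec_)
open import Relation.Nullary.Decidable using (⌊_⌋)

StrictInc : {k : ℕ} → (Fin k → ℕ) → Set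
StrictInc {k} f = (a b : Fin k) → a Fin.< b → f a ℕ.< f b

-- peaksFrom k l: positions (1-based, first element of l at position k) of peaks.
peaksFrom : ℕ → List ℕ → List ℕ
peaksFrom k (a ∷ b ∷ c ∷ r) =
  (if ⌊ a ℕ.<? b ⌋ ∧ ⌊ c ℕ.<? b ⌋ then suc k ∷ [] else []) ++ peaksFrom (suc k) (b ∷ c ∷ r)
peaksFrom k _ = []

peaks : List ℕ → List ℕ
peaks = peaksFrom 1

allWords : (m k : ℕ) → List (Vec (Fin m) k)
allWords m zero = [] ∷ []
allWords m (suc k) = concatMap (λ x → map (x ∷_) (allWords m k)) (List.allFin m)

-- A permutation of {1..n} is represented as a word a_1…a_n over Fin n with
-- distinct letters (values shifted down by 1, which does not change peaks).
-- π ∈ P(S;n) : π is a permutation and peaks(π) = S as sets.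
inP : (n : ℕ) (S : List ℕ) (v : Vec (Fin n) n) → Dec _
inP n S v = UDec.unique? (Fin._≟_ {n}) (Vec.toList v)
  ×-dec ((peaks (map toℕ (Vec.toList v)) ⊆? S) ×-dec (S ⊆? peaks (map toℕ (Vec.toList v))))

countP : List ℕ → ℕ → ℕ
countP S n = length (filter (inP n S) (allWords n n))

Sn : (s t : ℕ) → (Fin s → ℕ) → (Fin t → ℕ) → ℕ → List ℕ
Sn s t i j n = List.tabulate i ++ List.tabulate (λ b → n ∸ j b)

-- n for which S_n is defined as displayed: i_1<…<i_s<n-j_t<…<n-j_1 (with n-j_b positive).
ValidN : (s t : ℕ) → (Fin s → ℕ) → (Fin t → ℕ) → ℕ → Set
ValidN s t i j n = ((b : Fin t) → j b < n) × ((a : Fin s) (b : Fin t) → i a ℕ.+ j b < n)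

evalPoly : {d : ℕ} → (Fin (suc d) → ℚ) → ℚ → ℚ
evalPoly {d} c x = List.foldr (λ a acc → a ℚ.+ x ℚ.* acc) 0ℚ (List.tabulate c)

ℤtoℚ : ℤ → ℚ
ℤtoℚ z = z ℚ./ 1

ℕtoℚ : ℕ → ℚ
ℕtoℚ k = ℤtoℚ (ℤ.+ k)

IntegerValued : {d : ℕ} → (Fin (suc d) → ℚ) → Set
IntegerValued c = (z : ℤ) → ∃[ m ] evalPoly c (ℤtoℚ z) ≡ ℤtoℚ m
  where open import Relation.Binary.PropositionalEquality using (_≡_)

degFormula : (s t : ℕ) → (Fin s → ℕ) → (Fin t → ℕ) → ℕ
degFormula zero    zero    i j = 0
degFormula (suc s) zero    i j = i (fromℕ s) ∸ 1
degFormula zero    (suc t) i j = j (fromℕ t)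
degFormula (suc s) (suc t) i j = i (fromℕ s) ℕ.+ j (fromℕ t) ∸ 1

{-# OPTIONS --safe #-}
module Submission where

-- Encode the peak set of a permutation of n letters as a pattern of n bits and let N(P) be
-- the number of permutations with pattern P.  Choosing the set of letters in front of a cut
-- and standardising both sides gives, for k the length of x0 and n the total length,
--   (n choose k) N(x0) N(0y) = N(x00y) + N(x10y) + N(x01y),
-- since cutting only forgets whether one of the two letters at the cut is a peak.  Together
-- with N(0ⁿ) = 2ⁿ⁻¹ this rule determines all counts.  Write S_n as X 0ᵐ Y with X ending and
-- Y starting in 1.  Cutting before the last 1 of X (or, when X is empty, after the first 1
-- of Y) expresses N(X 0ᵐ Y) through patterns with shorter X or Y, so the polynomials are
-- found by recursion in the binomial basis: their coefficients are integers, only the term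
-- with the binomial coefficient reaches the top degree, and its factor is nonzero because it
-- counts the two halves of any admissible permutation.

-- The powers of two explain the shape of the recursion. If the halves x0 and 0y have lengths k, l
-- and α, β peaks, their powers multiply to 2 ^ ((k - α - 1) + (l - β - 1)) = 2 ^ (n - (α + β + 1) -
-- 1), exactly the power that belongs to the two patterns with one more peak. The pattern x00y has
-- only α + β peaks and so enters with a factor 2, never with a fraction: integral Newton
-- coefficients stay integral. Shortening X or Y moves a 1 towards an end of the pattern or towards
-- another 1. Patterns with a 1 at an end or with two neighbouring 1s have count 0, and there the
-- recursion stops with the zero polynomial. The formula 2ⁿ⁻¹ fails for the empty permutation, so
-- the recursion keeps at least one 0 in the gap; a gap of length zero is treated apart and is
-- admissible only for n = 0.

-- Sums over arrangements of a list, and cutting a word in two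

module Arrangements where

  open import Data.Nat using (ℕ; zero; suc; _+_; _*_; _^_; _≤_; _<_; s≤s)
  open import Data.Nat.Properties
  open import Algebra.Properties.CommutativeSemigroup +-commutativeSemigroup
    using () renaming (interchange to +-interchange)
  open import Data.Nat.Combinatorics using (_C_; nCk+nC[k+1]≡[n+1]C[k+1]; nCn≡1)
  open import Data.Nat.Solver using (module +-*-Solver)
  open import Data.List using (List; []; _∷_; length; map; applyUpTo; upTo)
  open import Data.List.Properties using (length-upTo; map-applyUpTo)
  open import Function using (id; _∘_)
  open import Relation.Binary.PropositionalEquality
  open ≡-Reasoning

  private variable
    A B : Set

  -- Sums over the ways to single out an element of a list, to split a list into
  -- two complementary sublists, and to arrange k of its elements in a row.
  Sel : List A → (A → List A → ℕ) → ℕ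
  Sel []       F = 0
  Sel (x ∷ xs) F = F x xs + Sel xs (λ y r → F y (x ∷ r))

  Spl : List A → (List A → List A → ℕ) → ℕ
  Spl []       F = F [] []
  Spl (x ∷ xs) F = Spl xs (λ a b → F (x ∷ a) b) + Spl xs (λ a b → F a (x ∷ b))

  Arr : ℕ → List A → (List A → ℕ) → ℕ
  Arr zero    xs f = f []
  Arr (suc k) xs f = Sel xs (λ x r → Arr k r (λ w → f (x ∷ w)))

  Sel-cong : (xs : List A) {F G : A → List A → ℕ} →
    (∀ x r → length xs ≡ suc (length r) → F x r ≡ G x r) → Sel xs F ≡ Sel xs G
  Sel-cong []       e = refl
  Sel-cong (x ∷ xs) e =
    cong₂ _+_ (e x xs refl) (Sel-cong xs λ y r l → e y (x ∷ r) (cong suc l))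

  Spl-cong : (xs : List A) {F G : List A → List A → ℕ} →
    (∀ a b → F a b ≡ G a b) → Spl xs F ≡ Spl xs G
  Spl-cong []       e = e [] []
  Spl-cong (x ∷ xs) e =
    cong₂ _+_ (Spl-cong xs λ a b → e (x ∷ a) b) (Spl-cong xs λ a b → e a (x ∷ b))

  Arr-cong-length : ∀ k (xs : List A) {f g : List A → ℕ} →
    (∀ w → length w ≡ k → f w ≡ g w) → Arr k xs f ≡ Arr k xs g
  Arr-cong-length zero    xs e = e [] refl
  Arr-cong-length (suc k) xs e =
    Sel-cong xs λ x r _ → Arr-cong-length k r (λ w l → e (x ∷ w) (cong suc l))

  Arr-cong : ∀ k (xs : List A) {f g : List A → ℕ} → (∀ w → f w ≡ g w) → Arr k xs f ≡ Arr k xs g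
  Arr-cong k xs e = Arr-cong-length k xs λ w _ → e w

  Sel-+ : (xs : List A) (F G : A → List A → ℕ) →
    Sel xs (λ x r → F x r + G x r) ≡ Sel xs F + Sel xs G
  Sel-+ []       F G = refl
  Sel-+ (x ∷ xs) F G =
    trans (cong (F x xs + G x xs +_) (Sel-+ xs _ _)) (+-interchange (F x xs) (G x xs) _ _)

  Spl-+ : (xs : List A) (F G : List A → List A → ℕ) →
    Spl xs (λ a b → F a b + G a b) ≡ Spl xs F + Spl xs G
  Spl-+ []       F G = refl
  Spl-+ (x ∷ xs) F G =
    trans (cong₂ _+_ (Spl-+ xs _ _) (Spl-+ xs _ _)) (+-interchange (Spl xs (λ a b → F (x ∷ a) b)) _ _ _)

  Arr-+ : ∀ k (xs : List A) (f g : List A → ℕ) →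
    Arr k xs (λ w → f w + g w) ≡ Arr k xs f + Arr k xs g
  Arr-+ zero    xs f g = refl
  Arr-+ (suc k) xs f g = trans (Sel-cong xs λ x r _ → Arr-+ k r _ _) (Sel-+ xs _ _)

  Sel-* : ∀ c (xs : List A) (F : A → List A → ℕ) → Sel xs (λ x r → c * F x r) ≡ c * Sel xs F
  Sel-* c []       F = sym (*-zeroʳ c)
  Sel-* c (x ∷ xs) F =
    trans (cong (c * F x xs +_) (Sel-* c xs _)) (sym (*-distribˡ-+ c (F x xs) _))

  Sel-*ʳ : ∀ c (xs : List A) (F : A → List A → ℕ) → Sel xs (λ x r → F x r * c) ≡ Sel xs F * c
  Sel-*ʳ c xs F =
    trans (Sel-cong xs λ x r _ → *-comm (F x r) c) (trans (Sel-* c xs F) (*-comm c _))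

  Arr-* : ∀ k c (xs : List A) (f : List A → ℕ) → Arr k xs (λ w → c * f w) ≡ c * Arr k xs f
  Arr-* zero    c xs f = refl
  Arr-* (suc k) c xs f = trans (Sel-cong xs λ x r _ → Arr-* k c r _) (Sel-* c xs _)

  Arr-zero : ∀ k (xs : List A) {f : List A → ℕ} → (∀ w → f w ≡ 0) → Arr k xs f ≡ 0
  Arr-zero k xs e = trans (Arr-cong k xs e) (Arr-* k 0 xs (λ _ → 0))

  Sel-map : (φ : A → B) (xs : List A) (F : B → List B → ℕ) →
    Sel (map φ xs) F ≡ Sel xs (λ x r → F (φ x) (map φ r))
  Sel-map φ []       F = refl
  Sel-map φ (x ∷ xs) F = cong (F (φ x) (map φ xs) +_) (Sel-map φ xs _)

  Arr-map : ∀ k (φ : A → B) (xs : List A) (f : List B → ℕ) →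
    Arr k (map φ xs) f ≡ Arr k xs (f ∘ map φ)
  Arr-map zero    φ xs f = refl
  Arr-map (suc k) φ xs f = trans (Sel-map φ xs _) (Sel-cong xs λ x r _ → Arr-map k φ r _)

  -- Both sides range over the ways to distribute the list into one marked element and two blocks.
  Sel-Spl : (xs : List A) (F : A → List A → List A → ℕ) →
    Sel xs (λ x r → Spl r (F x)) ≡ Spl xs (λ a b → Sel a (λ x a′ → F x a′ b))
  Sel-Spl []       F = refl
  Sel-Spl (x ∷ xs) F = begin
    Spl xs (F x) + Sel xs (λ y r → Spl r (λ a b → F y (x ∷ a) b) + Spl r (λ a b → F y a (x ∷ b)))
      ≡⟨ cong (Spl xs (F x) +_) (Sel-+ xs _ _) ⟩
    Spl xs (F x) + (Sel xs (λ y r → Spl r (λ a b → F y (x ∷ a) b))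
                  + Sel xs (λ y r → Spl r (λ a b → F y a (x ∷ b))))
      ≡⟨ cong (Spl xs (F x) +_) (cong₂ _+_ (Sel-Spl xs _) (Sel-Spl xs _)) ⟩
    Spl xs (F x) + (Spl xs (λ a b → Sel a (λ y a′ → F y (x ∷ a′) b))
                  + Spl xs (λ a b → Sel a (λ y a′ → F y a′ (x ∷ b))))
      ≡⟨ sym (+-assoc (Spl xs (F x)) _ _) ⟩
    (Spl xs (F x) + Spl xs (λ a b → Sel a (λ y a′ → F y (x ∷ a′) b)))
                  + Spl xs (λ a b → Sel a (λ y a′ → F y a′ (x ∷ b)))
      ≡⟨ cong (_+ Spl xs (λ a b → Sel a (λ y a′ → F y a′ (x ∷ b)))) (sym (Spl-+ xs _ _)) ⟩
    Spl (x ∷ xs) (λ a b → Sel a (λ y a′ → F y a′ b)) ∎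

  infixr 7 _⋆_
  -- Convolution over cuts: the value at w is the sum of g u * h v over all ways to write w as u
  -- followed by v, empty factors included.
  _⋆_ : (List A → ℕ) → (List A → ℕ) → List A → ℕ
  (g ⋆ h) []      = g [] * h []
  (g ⋆ h) (x ∷ w) = g [] * h (x ∷ w) + ((λ u → g (x ∷ u)) ⋆ h) w

  ifEmpty : ℕ → List A → ℕ
  ifEmpty c []      = c
  ifEmpty c (_ ∷ _) = 0

  Spl-zero : (xs : List A) → Spl xs (λ _ _ → 0) ≡ 0
  Spl-zero []       = refl
  Spl-zero (x ∷ xs) = cong₂ _+_ (Spl-zero xs) (Spl-zero xs)

  Spl-ifEmpty : ∀ c (xs : List A) (G : List A → ℕ) →
    Spl xs (λ a b → ifEmpty c a * G b) ≡ c * G xs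
  Spl-ifEmpty c []       G = refl
  Spl-ifEmpty c (x ∷ xs) G = cong₂ _+_ (Spl-zero xs) (Spl-ifEmpty c xs (λ b → G (x ∷ b)))

  Arr-unfold : (a : List A) (g : List A → ℕ) →
    Arr (length a) a g ≡ ifEmpty (g []) a + Sel a (λ x r → Arr (length r) r (λ u → g (x ∷ u)))
  Arr-unfold []      g = sym (+-identityʳ _)
  Arr-unfold (x ∷ a) g = Sel-cong (x ∷ a) λ y r l →
    cong (λ k → Arr k r (λ u → g (y ∷ u))) (suc-injective l)

  -- Arranging the letters and then cutting the word amounts to deciding first which letters stand
  -- in front of the cut and then arranging each side. The cut with empty front half is the only one
  -- not reached by recursion on the first letter; `ifEmpty` turns it into a sum over splittings as
  -- well.
  Arr-⋆ : ∀ n (xs : List A) (g h : List A → ℕ) → length xs ≡ n →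
    Arr n xs (g ⋆ h) ≡ Spl xs (λ a b → Arr (length a) a g * Arr (length b) b h)
  Arr-⋆ zero    []       g h _  = refl
  Arr-⋆ (suc n) xs g h eq = begin
    Sel xs (λ x r → Arr n r (λ w → g [] * h (x ∷ w) + ((λ u → g (x ∷ u)) ⋆ h) w))
      ≡⟨ Sel-cong xs (λ x r l → Arr-+ n r _ _) ⟩
    Sel xs (λ x r → Arr n r (λ w → g [] * h (x ∷ w)) + Arr n r ((λ u → g (x ∷ u)) ⋆ h))
      ≡⟨ Sel-+ xs _ _ ⟩
    Arr (suc n) xs (λ w → g [] * h w) + Sel xs (λ x r → Arr n r ((λ u → g (x ∷ u)) ⋆ h))
      ≡⟨ cong₂ _+_ (Arr-* (suc n) (g []) xs h) (Sel-cong xs λ x r l →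
           Arr-⋆ n r (λ u → g (x ∷ u)) h (suc-injective (trans (sym l) eq))) ⟩
    g [] * Arr (suc n) xs h
      + Sel xs (λ x r → Spl r (λ a b → Arr (length a) a (λ u → g (x ∷ u)) * Arr (length b) b h))
      ≡⟨ cong₂ _+_ (cong (λ k → g [] * Arr k xs h) (sym eq)) (Sel-Spl xs _) ⟩
    g [] * Arr (length xs) xs h
      + Spl xs (λ a b → Sel a (λ x r → Arr (length r) r (λ u → g (x ∷ u)) * Arr (length b) b h))
      ≡⟨ cong₂ _+_ (sym (Spl-ifEmpty (g []) xs (λ b → Arr (length b) b h)))
           (Spl-cong xs λ a b → Sel-*ʳ (Arr (length b) b h) a _) ⟩
    Spl xs (λ a b → ifEmpty (g []) a * Arr (length b) b h)
      + Spl xs (λ a b → Sel a (λ x r → Arr (length r) r (λ u → g (x ∷ u))) * Arr (length b) b h)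
      ≡⟨ sym (Spl-+ xs _ _) ⟩
    Spl xs (λ a b → ifEmpty (g []) a * Arr (length b) b h
      + Sel a (λ x r → Arr (length r) r (λ u → g (x ∷ u))) * Arr (length b) b h)
      ≡⟨ Spl-cong xs (λ a b → trans (sym (*-distribʳ-+ (Arr (length b) b h) (ifEmpty (g []) a) _))
           (cong (_* Arr (length b) b h) (sym (Arr-unfold a g)))) ⟩
    Spl xs (λ a b → Arr (length a) a g * Arr (length b) b h) ∎

  data Inc : ℕ → List ℕ → Set where
    []  : ∀ {l} → Inc l []
    _∷_ : ∀ {l a as} → l ≤ a → Inc (suc a) as → Inc l (a ∷ as)

  Inc-weaken : ∀ {l m as} → l ≤ m → Inc m as → Inc l as
  Inc-weaken l≤m []       = []
  Inc-weaken l≤m (p ∷ ps) = ≤-trans l≤m p ∷ ps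

  StrictlyMonotone : (ℕ → ℕ) → Set
  StrictlyMonotone φ = ∀ {i j} → i < j → φ i < φ j

  OrderInvariant : (List ℕ → ℕ) → Set
  OrderInvariant g = ∀ φ → StrictlyMonotone φ → ∀ w → g (map φ w) ≡ g w

  -- Past the end of the list the values continue consecutively, so that the enumeration of the list
  -- becomes a strictly monotone map on all of ℕ, as `OrderInvariant` demands.
  extend : ℕ → List ℕ → ℕ → ℕ
  extend l []       i       = l + i
  extend l (a ∷ as) zero    = a
  extend l (a ∷ as) (suc i) = extend (suc a) as i

  extend-≥ : ∀ {l as} → Inc l as → ∀ i → l ≤ extend l as i
  extend-≥ {l} [] i             = m≤m+n l i
  extend-≥ (p ∷ ps) zero        = p
  extend-≥ (p ∷ ps) (suc i)     = ≤-trans (m≤n⇒m≤1+n p) (extend-≥ ps i)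

  extend-mono : ∀ {l as} → Inc l as → StrictlyMonotone (extend l as)
  extend-mono {l} []   i<j                     = +-monoʳ-< l i<j
  extend-mono (p ∷ ps) {zero}  {suc j} i<j     = extend-≥ ps j
  extend-mono (p ∷ ps) {suc i} {suc j} (s≤s q) = extend-mono ps q

  applyUpTo-extend : ∀ l as → applyUpTo (extend l as) (length as) ≡ as
  applyUpTo-extend l []       = refl
  applyUpTo-extend l (a ∷ as) = cong (a ∷_) (applyUpTo-extend (suc a) as)

  -- Standardisation: an increasing list is the image of 0, …, k-1 under a strictly monotone map.
  Arr-standardise : ∀ {l as g} → OrderInvariant g → Inc l as →
    Arr (length as) as g ≡ Arr (length as) (upTo (length as)) g
  Arr-standardise {l} {as} {g} inv inc = begin
    Arr k as g                             ≡⟨ cong (λ xs → Arr k xs g) (sym image) ⟩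
    Arr k (map φ (upTo k)) g               ≡⟨ Arr-map k φ (upTo k) g ⟩
    Arr k (upTo k) (g ∘ map φ)             ≡⟨ Arr-cong k (upTo k) (inv φ (extend-mono inc)) ⟩
    Arr k (upTo k) g                       ∎
    where
    k = length as
    φ = extend l as
    image : map φ (upTo k) ≡ as
    image = trans (map-applyUpTo id φ k) (applyUpTo-extend l as)

  Spl-cong-Inc : ∀ {l xs} {F G : List ℕ → List ℕ → ℕ} → Inc l xs →
    (∀ a b → Inc l a → Inc l b → F a b ≡ G a b) → Spl xs F ≡ Spl xs G
  Spl-cong-Inc []       e = e [] [] [] []
  Spl-cong-Inc {xs = x ∷ _} (p ∷ ps) e =
    cong₂ _+_ (Spl-cong-Inc ps λ a b ia ib → e (x ∷ a) b (p ∷ ia) (Inc-weaken (m≤n⇒m≤1+n p) ib))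
              (Spl-cong-Inc ps λ a b ia ib → e a (x ∷ b) (Inc-weaken (m≤n⇒m≤1+n p) ia) (p ∷ ib))

  -- This is the sum of (n C a) * φ a b over a + b = n, unfolded along Pascal's rule: each of n
  -- letters goes to the left or to the right.
  BinSum : ℕ → (ℕ → ℕ → ℕ) → ℕ
  BinSum zero    φ = φ 0 0
  BinSum (suc n) φ = BinSum n (λ a b → φ (suc a) b) + BinSum n (λ a b → φ a (suc b))

  Spl-length : (xs : List A) (φ : ℕ → ℕ → ℕ) →
    Spl xs (λ a b → φ (length a) (length b)) ≡ BinSum (length xs) φ
  Spl-length []       φ = refl
  Spl-length (x ∷ xs) φ =
    cong₂ _+_ (Spl-length xs (λ a b → φ (suc a) b)) (Spl-length xs (λ a b → φ a (suc b)))

  BinSum-cong : ∀ n {φ ψ} → (∀ a b → a + b ≡ n → φ a b ≡ ψ a b) → BinSum n φ ≡ BinSum n ψ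
  BinSum-cong zero    e = e 0 0 refl
  BinSum-cong (suc n) e = cong₂ _+_
    (BinSum-cong n λ a b s → e (suc a) b (cong suc s))
    (BinSum-cong n λ a b s → e a (suc b) (trans (+-suc a b) (cong suc s)))

  BinSum-const : ∀ n c → BinSum n (λ _ _ → c) ≡ 2 ^ n * c
  BinSum-const zero    c = sym (+-identityʳ c)
  BinSum-const (suc n) c rewrite BinSum-const n c =
    solve 2 (λ p c → p :* c :+ p :* c := (p :+ (p :+ con 0)) :* c) refl (2 ^ n) c
    where open +-*-Solver

  BinSum-zero : ∀ n {φ} → (∀ a b → a + b ≡ n → φ a b ≡ 0) → BinSum n φ ≡ 0
  BinSum-zero n e = trans (BinSum-cong n e) (trans (BinSum-const n 0) (*-zeroʳ (2 ^ n)))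

  BinSum-single : ∀ n k m {φ} → k + m ≡ n → (∀ a b → a ≢ k → φ a b ≡ 0) →
    BinSum n φ ≡ (n C k) * φ k m
  BinSum-single zero    zero    zero    {φ} eq e = sym (*-identityˡ (φ 0 0))
  BinSum-single (suc n) zero    (suc m) {φ} eq e = begin
    BinSum n (λ a b → φ (suc a) b) + BinSum n (λ a b → φ a (suc b))
      ≡⟨ cong₂ _+_ (BinSum-zero n λ a b _ → e (suc a) b λ ())
           (BinSum-single n 0 m (suc-injective eq) λ a b → e a (suc b)) ⟩
    (n C 0) * φ 0 (suc m)     ≡⟨⟩
    (suc n C 0) * φ 0 (suc m) ∎
  BinSum-single (suc n) (suc k) zero    {φ} eq e with trans (sym (+-identityʳ k)) (suc-injective eq)
  ... | refl = begin
    BinSum n (λ a b → φ (suc a) b) + BinSum n (λ a b → φ a (suc b))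
      ≡⟨ cong₂ _+_ (BinSum-single n n 0 (suc-injective eq) λ a b a≢k → e (suc a) b (a≢k ∘ suc-injective))
           (BinSum-zero n λ a b s → e a (suc b) λ { refl → 1+n≰n (m+n≤o⇒m≤o (suc n) (≤-reflexive s)) }) ⟩
    (n C n) * φ (suc n) 0 + 0     ≡⟨ +-identityʳ _ ⟩
    (n C n) * φ (suc n) 0         ≡⟨ cong (_* φ (suc n) 0) (trans (nCn≡1 n) (sym (nCn≡1 (suc n)))) ⟩
    (suc n C suc n) * φ (suc n) 0 ∎
  BinSum-single (suc n) (suc k) (suc m) {φ} eq e = begin
    BinSum n (λ a b → φ (suc a) b) + BinSum n (λ a b → φ a (suc b))
      ≡⟨ cong₂ _+_ (BinSum-single n k (suc m) (suc-injective eq) λ a b a≢k → e (suc a) b (a≢k ∘ suc-injective))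
           (BinSum-single n (suc k) m (trans (sym (+-suc k m)) (suc-injective eq)) λ a b → e a (suc b)) ⟩
    (n C k) * φ (suc k) (suc m) + (n C suc k) * φ (suc k) (suc m)
      ≡⟨ sym (*-distribʳ-+ (φ (suc k) (suc m)) (n C k) _) ⟩
    ((n C k) + (n C suc k)) * φ (suc k) (suc m)
      ≡⟨ cong (_* φ (suc k) (suc m)) (nCk+nC[k+1]≡[n+1]C[k+1] n k) ⟩
    (suc n C suc k) * φ (suc k) (suc m) ∎

  Perm : ℕ → (List ℕ → ℕ) → ℕ
  Perm n g = Arr n (upTo n) g

  Inc-upTo : ∀ n → Inc 0 (upTo n)
  Inc-upTo n = go n 0 id λ _ → refl
    where
    go : ∀ n l (f : ℕ → ℕ) → (∀ i → f i ≡ l + i) → Inc l (applyUpTo f n)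
    go zero    l f e = []
    go (suc n) l f e = ≤-reflexive (trans (sym (+-identityʳ l)) (sym (e 0)))
      ∷ subst (λ a → Inc (suc a) (applyUpTo (f ∘ suc) n)) (sym (trans (e 0) (+-identityʳ l)))
          (go n (suc l) (f ∘ suc) λ i → trans (e (suc i)) (+-suc l i))

  -- After standardisation a half depends on its set of letters only through the size of that set,
  -- so the sum over splittings collapses to one over sizes.
  Perm-⋆ : ∀ n {g h} → OrderInvariant g → OrderInvariant h →
    Perm n (g ⋆ h) ≡ BinSum n (λ a b → Perm a g * Perm b h)
  Perm-⋆ n {g} {h} ig ih = begin
    Arr n (upTo n) (g ⋆ h)
      ≡⟨ Arr-⋆ n (upTo n) g h (length-upTo n) ⟩
    Spl (upTo n) (λ a b → Arr (length a) a g * Arr (length b) b h)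
      ≡⟨ Spl-cong-Inc (Inc-upTo n) (λ a b ia ib →
           cong₂ _*_ (Arr-standardise ig ia) (Arr-standardise ih ib)) ⟩
    Spl (upTo n) (λ a b → Perm (length a) g * Perm (length b) h)
      ≡⟨ Spl-length (upTo n) (λ a b → Perm a g * Perm b h) ⟩
    BinSum (length (upTo n)) (λ a b → Perm a g * Perm b h)
      ≡⟨ cong (λ k → BinSum k (λ a b → Perm a g * Perm b h)) (length-upTo n) ⟩
    BinSum n (λ a b → Perm a g * Perm b h) ∎

-- Counting permutations by peak pattern

module PeakPatterns where

  open Arrangements
  open import Data.Nat using (ℕ; zero; suc; _+_; _*_; _^_; _≤_; _<_; _<?_)
  open import Data.Nat.Properties
  open import Data.Nat.Combinatorics using (_C_)
  open import Data.Nat.Solver using (module +-*-Solver)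
  open import Data.List using (List; []; _∷_; _++_; length; map; replicate; upTo)
  open import Data.List.Properties using (length-++; length-replicate; length-upTo)
  open import Data.Bool using (Bool; true; false; not; _∧_)
  open import Data.Sum using (inj₁; inj₂)
  open import Data.Empty using (⊥-elim)
  open import Relation.Nullary using (¬_; yes; no)
  open import Relation.Nullary.Decidable using (⌊_⌋; dec-true; dec-false; isYes≗does)
  open import Relation.Binary.PropositionalEquality
  open ≡-Reasoning

  asc : ℕ → ℕ → Bool
  asc a c = ⌊ a <? c ⌋

  -- The peak indicator of a word, one bit per letter; the first argument tells whether the
  -- first letter is preceded by a smaller one.  A descent is the negation of an ascent,
  -- which is right for words with distinct letters.
  pat : Bool → List ℕ → List Bool
  pat b []          = []
  pat b (a ∷ [])    = false ∷ []
  pat b (a ∷ c ∷ r) = (b ∧ not (asc a c)) ∷ pat (asc a c) (c ∷ r)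

  𝟙 : Bool → ℕ
  𝟙 true  = 1
  𝟙 false = 0

  δᵇ : Bool → Bool → ℕ
  δᵇ true  c = 𝟙 c
  δᵇ false c = 𝟙 (not c)

  -- Kronecker's delta as a product over the bits, so that the first bit can be pulled out of a sum
  -- as a factor.
  δ : List Bool → List Bool → ℕ
  δ []       []       = 1
  δ []       (_ ∷ _)  = 0
  δ (_ ∷ _)  []       = 0
  δ (b ∷ bs) (c ∷ cs) = δᵇ b c * δ bs cs

  N : List Bool → ℕ
  N P = Perm (length P) (λ w → δ (pat false w) P)

  asc-yes : ∀ {a c} → a < c → asc a c ≡ true
  asc-yes {a} {c} p = trans (isYes≗does (a <? c)) (dec-true (a <? c) p)

  asc-no : ∀ {a c} → ¬ a < c → asc a c ≡ false
  asc-no {a} {c} p = trans (isYes≗does (a <? c)) (dec-false (a <? c) p)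

  asc-map : ∀ φ → StrictlyMonotone φ → ∀ a c → asc (φ a) (φ c) ≡ asc a c
  asc-map φ mono a c with a <? c
  ... | yes a<c = asc-yes (mono a<c)
  ... | no  a≮c = asc-no (≤⇒≯ (φ-mono-≤ (≮⇒≥ a≮c)))
    where
    φ-mono-≤ : ∀ {i j} → i ≤ j → φ i ≤ φ j
    φ-mono-≤ i≤j with m≤n⇒m<n∨m≡n i≤j
    ... | inj₁ i<j = <⇒≤ (mono i<j)
    ... | inj₂ i≡j = ≤-reflexive (cong φ i≡j)

  pat-map : ∀ φ → StrictlyMonotone φ → ∀ b w → pat b (map φ w) ≡ pat b w
  pat-map φ mono b []          = refl
  pat-map φ mono b (a ∷ [])    = refl
  pat-map φ mono b (a ∷ c ∷ r) = trans
    (cong (λ j → (b ∧ not j) ∷ pat j (map φ (c ∷ r))) (asc-map φ mono a c))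
    (cong ((b ∧ not (asc a c)) ∷_) (pat-map φ mono (asc a c) (c ∷ r)))

  δ-pat-invariant : ∀ P → OrderInvariant (λ w → δ (pat false w) P)
  δ-pat-invariant P φ mono w = cong (λ bs → δ bs P) (pat-map φ mono false w)

  length-pat : ∀ b w → length (pat b w) ≡ length w
  length-pat b []          = refl
  length-pat b (a ∷ [])    = refl
  length-pat b (a ∷ c ∷ r) = cong suc (length-pat (asc a c) (c ∷ r))

  δᵇ-refl : ∀ b → δᵇ b b ≡ 1
  δᵇ-refl true  = refl
  δᵇ-refl false = refl

  δ-refl : ∀ bs → δ bs bs ≡ 1
  δ-refl []       = refl
  δ-refl (b ∷ bs) = cong₂ _*_ (δᵇ-refl b) (δ-refl bs)

  δ-≢ : ∀ bs cs → bs ≢ cs → δ bs cs ≡ 0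
  δ-≢ []           []           ne = ⊥-elim (ne refl)
  δ-≢ []           (_ ∷ _)      ne = refl
  δ-≢ (_ ∷ _)      []           ne = refl
  δ-≢ (true ∷ bs)  (true ∷ cs)  ne = trans (+-identityʳ _) (δ-≢ bs cs λ e → ne (cong (true ∷_) e))
  δ-≢ (true ∷ bs)  (false ∷ cs) ne = refl
  δ-≢ (false ∷ bs) (true ∷ cs)  ne = refl
  δ-≢ (false ∷ bs) (false ∷ cs) ne = trans (+-identityʳ _) (δ-≢ bs cs λ e → ne (cong (false ∷_) e))

  -- A pattern has as many bits as its word has letters. Hence a single cut position contributes to
  -- the convolution of two patterns, and it carries one binomial coefficient.
  Perm-δ-length : ∀ n P → n ≢ length P → Perm n (λ w → δ (pat false w) P) ≡ 0
  Perm-δ-length n P ne = trans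
    (Arr-cong-length n (upTo n) {g = λ _ → 0} λ w l →
      δ-≢ (pat false w) P λ e → ne (trans (sym l) (trans (sym (length-pat false w)) (cong length e))))
    (Arr-zero n (upTo n) λ _ → refl)

  ⋆-cong : {g g′ h : List ℕ → ℕ} → (∀ u → g u ≡ g′ u) → ∀ w → (g ⋆ h) w ≡ (g′ ⋆ h) w
  ⋆-cong {h = h} e []      = cong (_* h []) (e [])
  ⋆-cong {h = h} e (x ∷ w) = cong₂ _+_ (cong (_* h (x ∷ w)) (e [])) (⋆-cong (λ u → e (x ∷ u)) w)

  ⋆-scale : ∀ c (g h : List ℕ → ℕ) w → ((λ u → c * g u) ⋆ h) w ≡ c * (g ⋆ h) w
  ⋆-scale c g h []      = *-assoc c (g []) (h [])
  ⋆-scale c g h (x ∷ w) = trans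
    (cong₂ _+_ (*-assoc c (g []) (h (x ∷ w))) (⋆-scale c (λ u → g (x ∷ u)) h w))
    (sym (*-distribˡ-+ c (g [] * h (x ∷ w)) _))

  ⋆-zero : (g h : List ℕ → ℕ) → (∀ u → g u ≡ 0) → ∀ w → (g ⋆ h) w ≡ 0
  ⋆-zero g h e w = trans (⋆-cong e w) (⋆-scale 0 (λ _ → 0) h w)

  δ-start-true : ∀ w y → δ (pat false w) (true ∷ y) ≡ 0
  δ-start-true []          y = refl
  δ-start-true (a ∷ [])    y = refl
  δ-start-true (a ∷ c ∷ r) y = refl

  -- A peak is followed by a descent, so the rest of the word is read in the state `false`, in which
  -- its first letter cannot be a peak.
  δ-adjacent : ∀ b w x y → δ (pat b w) (x ++ true ∷ true ∷ y) ≡ 0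
  δ-adjacent b []          []       y = refl
  δ-adjacent b []          (e ∷ x)  y = refl
  δ-adjacent b (a ∷ [])    []       y = refl
  δ-adjacent b (a ∷ [])    (true ∷ x)  y = refl
  δ-adjacent b (a ∷ [])    (false ∷ []) y = refl
  δ-adjacent b (a ∷ [])    (false ∷ _ ∷ x) y = refl
  δ-adjacent b (a ∷ c ∷ r) []       y with asc a c
  ... | false = trans (cong (δᵇ (b ∧ true) true *_) (δ-start-true (c ∷ r) y)) (*-zeroʳ (δᵇ (b ∧ true) true))
  δ-adjacent false (a ∷ c ∷ r) []   y | true = refl
  δ-adjacent true  (a ∷ c ∷ r) []   y | true = refl
  δ-adjacent b (a ∷ c ∷ r) (e ∷ x)  y =
    trans (cong (δᵇ (b ∧ not (asc a c)) e *_) (δ-adjacent (asc a c) (c ∷ r) x y))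
          (*-zeroʳ (δᵇ (b ∧ not (asc a c)) e))

  δ-end-true : ∀ b w x → δ (pat b w) (x ++ true ∷ []) ≡ 0
  δ-end-true b []          []       = refl
  δ-end-true b []          (e ∷ x)  = refl
  δ-end-true b (a ∷ [])    []       = refl
  δ-end-true b (a ∷ [])    (true ∷ x)  = refl
  δ-end-true b (a ∷ [])    (false ∷ []) = refl
  δ-end-true b (a ∷ [])    (false ∷ _ ∷ x) = refl
  δ-end-true b (a ∷ c ∷ []) []      = *-zeroʳ (δᵇ (b ∧ not (asc a c)) true)
  δ-end-true b (a ∷ c ∷ d ∷ r) []   = *-zeroʳ (δᵇ (b ∧ not (asc a c)) true)
  δ-end-true b (a ∷ c ∷ r) (e ∷ x)  =
    trans (cong (δᵇ (b ∧ not (asc a c)) e *_) (δ-end-true (asc a c) (c ∷ r) x))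
          (*-zeroʳ (δᵇ (b ∧ not (asc a c)) e))

  N-start-true : ∀ y → N (true ∷ y) ≡ 0
  N-start-true y = Arr-zero (suc (length y)) _ λ w → δ-start-true w y

  N-adjacent : ∀ x y → N (x ++ true ∷ true ∷ y) ≡ 0
  N-adjacent x y = Arr-zero (length (x ++ true ∷ true ∷ y)) _ λ w → δ-adjacent false w x y

  N-end-true : ∀ x → N (x ++ true ∷ []) ≡ 0
  N-end-true x = Arr-zero (length (x ++ true ∷ [])) _ λ w → δ-end-true false w x

  -- The state influences the first bit only: a letter that would be a peak after an ascent becomes
  -- a non-peak when it starts a word.
  δ-state : ∀ c r y → δ (pat true (c ∷ r)) (false ∷ y) + δ (pat true (c ∷ r)) (true ∷ y)
    ≡ δ (pat false (c ∷ r)) (false ∷ y)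
  δ-state c []      y = +-identityʳ _
  δ-state c (d ∷ r) y with asc c d
  ... | true  = +-identityʳ _
  ... | false = refl

  δ-short : ∀ x {y : List Bool} {e d : Bool} → δ (false ∷ []) (d ∷ x ++ e ∷ y) ≡ 0
  δ-short []      {d = d} = *-zeroʳ (δᵇ false d)
  δ-short (_ ∷ x) {d = d} = *-zeroʳ (δᵇ false d)

  -- Cutting a word after the position of the first displayed bit forgets exactly whether
  -- that position or the next one is a peak, and the two cannot both be peaks.
  cut : ∀ b x y w →
    ((λ u → δ (pat b u) (x ++ false ∷ [])) ⋆ (λ v → δ (pat false v) (false ∷ y))) w
    ≡ δ (pat b w) (x ++ false ∷ false ∷ y) + δ (pat b w) (x ++ true ∷ false ∷ y)
      + δ (pat b w) (x ++ false ∷ true ∷ y)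
  cut b []      y []          = refl
  cut b (e ∷ x) y []          = refl
  cut b []      y (a ∷ [])    = refl
  cut b []      y (a ∷ c ∷ r) = begin
    1 * h (c ∷ r) + ((λ u → δ (pat b (a ∷ c ∷ u)) (false ∷ [])) ⋆ h) r
      ≡⟨ cong₂ _+_ (+-identityʳ _) (⋆-zero _ h too-long r) ⟩
    h (c ∷ r) + 0
      ≡⟨ +-identityʳ _ ⟩
    h (c ∷ r)
      ≡⟨ junction b (asc a c) ⟩
    _ ∎
    where
    h : List ℕ → ℕ
    h v = δ (pat false v) (false ∷ y)
    too-long : ∀ u → δ (pat b (a ∷ c ∷ u)) (false ∷ []) ≡ 0
    too-long []      = *-zeroʳ (δᵇ (b ∧ not (asc a c)) false)
    too-long (d ∷ u) = *-zeroʳ (δᵇ (b ∧ not (asc a c)) false)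
    -- Here j says whether the word ascends from a to c. If it does, a is no peak and c may be one;
    -- if not, c is none and a is a peak exactly when b holds.
    junction : ∀ b j → h (c ∷ r) ≡
      δᵇ (b ∧ not j) false * δ (pat j (c ∷ r)) (false ∷ y)
      + δᵇ (b ∧ not j) true * δ (pat j (c ∷ r)) (false ∷ y)
      + δᵇ (b ∧ not j) false * δ (pat j (c ∷ r)) (true ∷ y)
    junction true  true  = trans (sym (δ-state c r y))
      (solve 2 (λ p q → p :+ q := con 1 :* p :+ con 0 :+ con 1 :* q) refl
        (δ (pat true (c ∷ r)) (false ∷ y)) (δ (pat true (c ∷ r)) (true ∷ y)))
      where open +-*-Solver
    junction false true  = trans (sym (δ-state c r y))
      (solve 2 (λ p q → p :+ q := con 1 :* p :+ con 0 :+ con 1 :* q) refl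
        (δ (pat true (c ∷ r)) (false ∷ y)) (δ (pat true (c ∷ r)) (true ∷ y)))
      where open +-*-Solver
    junction true  false = solve 1 (λ p → p := con 0 :+ con 1 :* p :+ con 0) refl (h (c ∷ r))
      where open +-*-Solver
    junction false false rewrite δ-start-true (c ∷ r) y =
      solve 1 (λ p → p := con 1 :* p :+ con 0 :+ con 0) refl (h (c ∷ r))
      where open +-*-Solver
  cut b (e ∷ x) y (a ∷ [])
    rewrite δ-short x {y = []} {false} {e} | δ-short x {y = false ∷ y} {false} {e}
          | δ-short x {y = false ∷ y} {true} {e} | δ-short x {y = true ∷ y} {false} {e} = refl
  cut b (e ∷ x) y (a ∷ c ∷ r) = begin
    δ (false ∷ []) (e ∷ x ++ false ∷ []) * h (c ∷ r)
      + ((λ u → δᵇ k e * δ (pat j (c ∷ u)) (x ++ false ∷ [])) ⋆ h) r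
      ≡⟨ cong₂ _+_ (cong (_* h (c ∷ r)) (δ-short x {[]} {false} {e})) (⋆-scale (δᵇ k e) _ h r) ⟩
    δᵇ k e * ((λ u → δ (pat j (c ∷ u)) (x ++ false ∷ [])) ⋆ h) r
      -- The cut with empty front half contributes zero. Putting it back completes the convolution
      -- over `c ∷ r`, to which the induction hypothesis applies.
      ≡⟨ cong (λ z → δᵇ k e * (z * h (c ∷ r) + ((λ u → δ (pat j (c ∷ u)) (x ++ false ∷ [])) ⋆ h) r)) (sym (nonempty x)) ⟩
    δᵇ k e * ((λ u → δ (pat j u) (x ++ false ∷ [])) ⋆ h) (c ∷ r)
      ≡⟨ cong (δᵇ k e *_) (cut j x y (c ∷ r)) ⟩
    δᵇ k e * (p + q + s)
      ≡⟨ solve 4 (λ d p q s → d :* (p :+ q :+ s) := d :* p :+ d :* q :+ d :* s) refl (δᵇ k e) p q s ⟩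
    δᵇ k e * p + δᵇ k e * q + δᵇ k e * s ∎
    where
    open +-*-Solver
    j = asc a c
    k = b ∧ not j
    h : List ℕ → ℕ
    h v = δ (pat false v) (false ∷ y)
    p = δ (pat j (c ∷ r)) (x ++ false ∷ false ∷ y)
    q = δ (pat j (c ∷ r)) (x ++ true ∷ false ∷ y)
    s = δ (pat j (c ∷ r)) (x ++ false ∷ true ∷ y)
    nonempty : ∀ x → δ [] (x ++ false ∷ []) ≡ 0
    nonempty []      = refl
    nonempty (_ ∷ _) = refl

  length-pair : ∀ x {d e : Bool} {y} → length (x ++ d ∷ e ∷ y) ≡ length (x ++ false ∷ []) + suc (length y)
  length-pair x {y = y} = begin
    length (x ++ _ ∷ _ ∷ y)                 ≡⟨ length-++ x ⟩
    length x + suc (suc (length y))       ≡⟨ sym (+-assoc (length x) 1 (suc (length y))) ⟩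
    length x + 1 + suc (length y)       ≡⟨ cong (_+ suc (length y)) (sym (length-++ x)) ⟩
    length (x ++ false ∷ []) + suc (length y) ∎

  N-split : ∀ x y →
    N (x ++ false ∷ false ∷ y) + N (x ++ true ∷ false ∷ y) + N (x ++ false ∷ true ∷ y)
    ≡ ((length (x ++ false ∷ []) + length (false ∷ y)) C length (x ++ false ∷ []))
      * (N (x ++ false ∷ []) * N (false ∷ y))
  N-split x y = begin
    N (x ++ false ∷ false ∷ y) + N (x ++ true ∷ false ∷ y) + N (x ++ false ∷ true ∷ y)
      ≡⟨ cong₂ _+_ (cong₂ _+_ (size false false) (size true false)) (size false true) ⟩
    Perm n (f false false) + Perm n (f true false) + Perm n (f false true)
      ≡⟨ cong (_+ Perm n (f false true)) (sym (Arr-+ n (upTo n) (f false false) (f true false))) ⟩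
    Perm n (λ w → f false false w + f true false w) + Perm n (f false true)
      ≡⟨ sym (Arr-+ n (upTo n) (λ w → f false false w + f true false w) (f false true)) ⟩
    Perm n (λ w → f false false w + f true false w + f false true w)
      ≡⟨ Arr-cong n (upTo n) (λ w → sym (cut false x y w)) ⟩
    Perm n (g ⋆ h)
      ≡⟨ Perm-⋆ n (δ-pat-invariant (x ++ false ∷ [])) (δ-pat-invariant (false ∷ y)) ⟩
    BinSum n (λ a b → Perm a g * Perm b h)
      ≡⟨ BinSum-single n k m refl (λ a b ne → cong (_* Perm b h) (Perm-δ-length a (x ++ false ∷ []) ne)) ⟩
    (n C k) * (N (x ++ false ∷ []) * N (false ∷ y)) ∎
    where
    k = length (x ++ false ∷ [])
    m = length (false ∷ y)
    n = k + m
    f : Bool → Bool → List ℕ → ℕ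
    f d e w = δ (pat false w) (x ++ d ∷ e ∷ y)
    g h : List ℕ → ℕ
    g u = δ (pat false u) (x ++ false ∷ [])
    h v = δ (pat false v) (false ∷ y)
    size : ∀ d e → N (x ++ d ∷ e ∷ y) ≡ Perm n (f d e)
    size d e = cong (λ l → Perm l (f d e)) (length-pair x)

  -- Permutations without peaks

  Sel-cong-Inc : ∀ {l} {xs} {F G : ℕ → List ℕ → ℕ} → Inc l xs →
    (∀ x r → l ≤ x → Inc l r → length xs ≡ suc (length r) → F x r ≡ G x r) → Sel xs F ≡ Sel xs G
  Sel-cong-Inc []       e = refl
  Sel-cong-Inc {xs = x ∷ xs} (p ∷ ps) e = cong₂ _+_
    (e x xs p (Inc-weaken (m≤n⇒m≤1+n p) ps) refl)
    (Sel-cong-Inc ps λ y r q ir l → e y (x ∷ r) (≤-trans (m≤n⇒m≤1+n p) q) (p ∷ ir) (cong suc l))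

  Sel-zero : (xs : List ℕ) → Sel xs (λ _ _ → 0) ≡ 0
  Sel-zero xs = Sel-* 0 xs (λ _ _ → 0)

  up down : ℕ → List ℕ → ℕ
  up p []        = 1
  up p (a ∷ w)   = 𝟙 (asc p a) * up a w
  down p []      = 1
  down p (a ∷ w) = 𝟙 (not (asc p a)) * down a w

  increasing decreasing : List ℕ → ℕ
  increasing []      = 1
  increasing (a ∷ w) = up a w
  decreasing []      = 1
  decreasing (a ∷ w) = down a w

  up-map : ∀ φ → StrictlyMonotone φ → ∀ a w → up (φ a) (map φ w) ≡ up a w
  up-map φ mono a []      = refl
  up-map φ mono a (c ∷ w) = cong₂ _*_ (cong 𝟙 (asc-map φ mono a c)) (up-map φ mono c w)

  down-map : ∀ φ → StrictlyMonotone φ → ∀ a w → down (φ a) (map φ w) ≡ down a w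
  down-map φ mono a []      = refl
  down-map φ mono a (c ∷ w) =
    cong₂ _*_ (cong (λ j → 𝟙 (not j)) (asc-map φ mono a c)) (down-map φ mono c w)

  increasing-invariant : OrderInvariant increasing
  increasing-invariant φ mono []      = refl
  increasing-invariant φ mono (a ∷ w) = up-map φ mono a w

  decreasing-invariant : OrderInvariant decreasing
  decreasing-invariant φ mono []      = refl
  decreasing-invariant φ mono (a ∷ w) = down-map φ mono a w

  -- All letters are used, so x occurs somewhere behind y, and an increasing word has no room there
  -- for a letter that is at most y.
  Arr-up-zero : ∀ k x r y → x ≤ y → length r ≡ k → Arr (suc k) (x ∷ r) (up y) ≡ 0
  Arr-up-zero k x r y x≤y l = begin
    Arr k r (λ w → 𝟙 (asc y x) * up x w) + Sel r (λ z r′ → Arr k (x ∷ r′) (λ w → 𝟙 (asc y z) * up z w))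
      ≡⟨ cong₂ _+_ (Arr-zero k r λ w → cong (λ j → 𝟙 j * up x w) (asc-no (≤⇒≯ x≤y)))
                   (trans (Sel-cong r (λ z r′ l′ → later k z r′ (trans (sym l) l′))) (Sel-zero r)) ⟩
    0 ∎
    where
    later : ∀ k z r′ → k ≡ suc (length r′) → Arr k (x ∷ r′) (λ w → 𝟙 (asc y z) * up z w) ≡ 0
    later (suc k) z r′ e with y <? z
    ... | no  _   = Arr-zero (suc k) (x ∷ r′) λ _ → refl
    ... | yes y<z = trans (Arr-* (suc k) 1 (x ∷ r′) (up z)) (trans (+-identityʳ _)
        (Arr-up-zero k x r′ z (≤-trans x≤y (<⇒≤ y<z)) (sym (suc-injective e))))

  -- Only the least letter can come first: any other start leaves it to be placed behind a larger
  -- one.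
  Arr-up : ∀ x as → Inc (suc x) as → Arr (length as) as (up x) ≡ 1
  Arr-up x []       _        = refl
  Arr-up x (a ∷ as) (p ∷ ps) = begin
    Arr k as (λ w → 𝟙 (asc x a) * up a w) + Sel as (λ z r → Arr k (a ∷ r) (λ w → 𝟙 (asc x z) * up z w))
      ≡⟨ cong₂ _+_ (trans (Arr-* k (𝟙 (asc x a)) as (up a)) (cong₂ _*_ (cong 𝟙 (asc-yes p)) (Arr-up a as ps)))
           (trans (Sel-cong-Inc ps (λ z r q _ l → trans (Arr-* k (𝟙 (asc x z)) (a ∷ r) (up z))
             (trans (cong (𝟙 (asc x z) *_) (trans (cong (λ k → Arr k (a ∷ r) (up z)) l)
               (Arr-up-zero (length r) a r z (<⇒≤ q) refl))) (*-zeroʳ (𝟙 (asc x z))))))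
             (Sel-zero as)) ⟩
    1 ∎
    where k = length as

  Arr-increasing : ∀ {l} as → Inc l as → Arr (length as) as increasing ≡ 1
  Arr-increasing []       _        = refl
  Arr-increasing (a ∷ as) (p ∷ ps) = cong₂ _+_ (Arr-up a as ps)
    (trans (Sel-cong-Inc ps (λ z r q _ l → trans (cong (λ k → Arr k (a ∷ r) (up z)) l)
      (Arr-up-zero (length r) a r z (<⇒≤ q) refl))) (Sel-zero as))

  Arr-down-zero : ∀ x as → Inc (suc x) as → ∀ k → Arr (suc k) as (down x) ≡ 0
  Arr-down-zero x as inc k = trans
    (Sel-cong-Inc inc λ z r q _ _ → Arr-zero k r λ w → cong (λ j → 𝟙 (not j) * down z w) (asc-yes q))
    (Sel-zero as)

  -- The least letter of a decreasing word is its last one, so it may be dropped.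
  Arr-down-last : ∀ k x r y → x ≤ y → Inc (suc x) r → length r ≡ k →
    Arr (suc k) (x ∷ r) (down y) ≡ Arr k r (down y)
  Arr-down-last zero    x [] y x≤y _   _ rewrite asc-no (≤⇒≯ x≤y) = refl
  Arr-down-last (suc k) x r  y x≤y inc l = cong₂ _+_
    (trans (Arr-* (suc k) (𝟙 (not (asc y x))) r (down x))
      (trans (cong (𝟙 (not (asc y x)) *_) (Arr-down-zero x r inc k)) (*-zeroʳ (𝟙 (not (asc y x))))))
    (Sel-cong-Inc inc λ z r′ q ir l′ →
      trans (Arr-* (suc k) (𝟙 (not (asc y z))) (x ∷ r′) (down z))
        (trans (cong (𝟙 (not (asc y z)) *_)
          (Arr-down-last k x r′ z (<⇒≤ q) ir (suc-injective (trans (sym l′) l))))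
          (sym (Arr-* k (𝟙 (not (asc y z))) r′ (down z)))))

  Arr-decreasing : ∀ {l} as → Inc l as → Arr (length as) as decreasing ≡ 1
  Arr-decreasing []           _        = refl
  Arr-decreasing (a ∷ [])     _        = refl
  Arr-decreasing (a ∷ c ∷ as) (p ∷ ps) = trans
    (cong₂ _+_ (Arr-down-zero a (c ∷ as) ps (length as))
      (Sel-cong-Inc ps λ z r q ir l → Arr-down-last (length as) a r z (<⇒≤ q) ir (sym (suc-injective l))))
    (Arr-decreasing (c ∷ as) ps)

  flat : Bool → List ℕ → ℕ
  flat b w = δ (pat b w) (replicate (length w) false)

  -- After an ascent the next descent would create a peak, so a word without peaks has to increase
  -- to its end.
  flat-true : ∀ a w → flat true (a ∷ w) ≡ up a w
  flat-true a []      = refl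
  flat-true a (c ∷ r) with asc a c
  ... | true  = cong (1 *_) (flat-true c r)
  ... | false = refl

  -- A word without peaks decreases and then increases; its least letter may be
  -- counted on either side.
  up+decreasing⋆increasing : ∀ a w → up a w + (down a ⋆ increasing) w ≡ 2 * flat false (a ∷ w)
  up+decreasing⋆increasing a []      = refl
  up+decreasing⋆increasing a (c ∷ r) = begin
    𝟙 (asc a c) * up c r + (1 * up c r + ((λ u → 𝟙 (not (asc a c)) * down c u) ⋆ increasing) r)
      ≡⟨ cong (λ z → 𝟙 (asc a c) * up c r + (1 * up c r + z)) (⋆-scale (𝟙 (not (asc a c))) (down c) increasing r) ⟩
    𝟙 (asc a c) * up c r + (1 * up c r + 𝟙 (not (asc a c)) * (down c ⋆ increasing) r)
      ≡⟨ step (asc a c) ⟩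
    2 * (1 * flat (asc a c) (c ∷ r)) ∎
    where
    open +-*-Solver
    step : ∀ j → 𝟙 j * up c r + (1 * up c r + 𝟙 (not j) * (down c ⋆ increasing) r)
               ≡ 2 * (1 * flat j (c ∷ r))
    step true  = trans (solve 1 (λ u → con 1 :* u :+ (con 1 :* u :+ con 0) := con 2 :* (con 1 :* u)) refl (up c r))
      (cong (λ z → 2 * (1 * z)) (sym (flat-true c r)))
    step false = trans (solve 2 (λ u v → con 1 :* u :+ con 1 :* v := u :+ v) refl (up c r) _)
      (trans (up+decreasing⋆increasing c r) (cong (2 *_) (sym (+-identityʳ (flat false (c ∷ r))))))

  Perm-increasing : ∀ n → Perm n increasing ≡ 1
  Perm-increasing n = subst (λ k → Arr k (upTo n) increasing ≡ 1) (length-upTo n) (Arr-increasing (upTo n) (Inc-upTo n))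

  Perm-decreasing : ∀ n → Perm n decreasing ≡ 1
  Perm-decreasing n = subst (λ k → Arr k (upTo n) decreasing ≡ 1) (length-upTo n) (Arr-decreasing (upTo n) (Inc-upTo n))

  -- Twice the count is the number of ways to choose which letters form a decreasing front part, the
  -- others following in increasing order: one for each of the 2 ^ suc n subsets.
  N-flat : ∀ n → N (replicate (suc n) false) ≡ 2 ^ n
  N-flat n = *-cancelˡ-≡ _ _ 2 (begin
    2 * N (replicate (suc n) false)
      ≡⟨ cong (λ l → 2 * Perm l (λ w → δ (pat false w) (replicate (suc n) false))) (length-replicate (suc n)) ⟩
    2 * Perm (suc n) (λ w → δ (pat false w) (replicate (suc n) false))
      ≡⟨ sym (Arr-* (suc n) 2 (upTo (suc n)) λ w → δ (pat false w) (replicate (suc n) false)) ⟩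
    Perm (suc n) (λ w → 2 * δ (pat false w) (replicate (suc n) false))
      ≡⟨ Arr-cong-length (suc n) (upTo (suc n)) pointwise ⟩
    Perm (suc n) (decreasing ⋆ increasing)
      ≡⟨ Perm-⋆ (suc n) decreasing-invariant increasing-invariant ⟩
    BinSum (suc n) (λ a b → Perm a decreasing * Perm b increasing)
      ≡⟨ BinSum-cong (suc n) (λ a b _ → cong₂ _*_ (Perm-decreasing a) (Perm-increasing b)) ⟩
    BinSum (suc n) (λ _ _ → 1)
      ≡⟨ BinSum-const (suc n) 1 ⟩
    2 ^ suc n * 1
      ≡⟨ *-identityʳ _ ⟩
    2 * 2 ^ n ∎)
    where
    pointwise : ∀ w → length w ≡ suc n →
      2 * δ (pat false w) (replicate (suc n) false) ≡ (decreasing ⋆ increasing) w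
    pointwise (a ∷ w) refl = trans (sym (up+decreasing⋆increasing a w))
      (cong (_+ (down a ⋆ increasing) w) (sym (+-identityʳ (up a w))))

-- Integer-valued polynomials in the binomial basis

module NewtonCoefficients where

  open PeakPatterns
  open import Data.Nat as ℕ using (ℕ; zero; suc; _∸_; _^_; _≤_; _<_; s≤s; _!)
  import Data.Nat.Properties as ℕ
  open import Data.Nat.DivMod using (m/n*n≡m)
  open import Data.Nat.Combinatorics using (_C_; nCk≡n!/k![n-k]!; k![n∸k]!∣n!; k>n⇒nCk≡0; nCk≡nC[n∸k])
  import Data.Nat.Solver as NatSolver
  open import Data.Integer using (ℤ; +_; 0ℤ; 1ℤ; _+_; _*_; _-_)
  import Data.Integer.Properties as ℤ
  open import Data.Integer.Solver using (module +-*-Solver)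
  open import Data.List using (List; []; _∷_; _++_; _ʳ++_; length; replicate; reverse)
  open import Data.List.Properties using (++-identityʳ; length-replicate; length-ʳ++; ʳ++-defn)
  open import Data.Bool using (Bool; true; false)
  open import Data.Sum using (inj₁; inj₂)
  open import Data.Product using (_,_)
  open import Relation.Nullary using (yes; no; contradiction)
  open import Relation.Binary.PropositionalEquality
  open ≡-Reasoning

  C-factorial : ∀ {n k} → k ≤ n → (n C k) ℕ.* (k ! ℕ.* (n ∸ k) !) ≡ n !
  C-factorial {n} {k} k≤n = trans
    (cong (ℕ._* (k ! ℕ.* (n ∸ k) !)) (nCk≡n!/k![n-k]! k≤n))
    (m/n*n≡m {{k ℕ.!* (n ∸ k) !≢0}} (k![n∸k]!∣n! k≤n))

  C-factorial-+ : ∀ k m → ((k ℕ.+ m) C k) ℕ.* (k ! ℕ.* m !) ≡ (k ℕ.+ m) !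
  C-factorial-+ k m = trans
    (cong (λ e → ((k ℕ.+ m) C k) ℕ.* (k ! ℕ.* e !)) (sym (ℕ.m+n∸m≡n k m)))
    (C-factorial (ℕ.m≤m+n k m))

  C-comm : ∀ k m → (k ℕ.+ m) C k ≡ (m ℕ.+ k) C m
  C-comm k m = trans (nCk≡nC[n∸k] (ℕ.m≤m+n k m)) (cong₂ _C_ (ℕ.+-comm k m) (ℕ.m+n∸m≡n k m))

  C-≢0 : ∀ k m → (k ℕ.+ m) C k ≢ 0
  C-≢0 k m e = ℕ.≢-nonZero⁻¹ ((k ℕ.+ m) !) {{(k ℕ.+ m) ℕ.!≢0}}
    (trans (sym (C-factorial-+ k m)) (cong (ℕ._* (k ! ℕ.* m !)) e))

  -- Both sides count the (k + r)-element subsets of a (k + m)-element set with k of their elements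
  -- marked. For r at most m, multiplication by the three factorials turns both into (k + m)!;
  -- otherwise both vanish.
  C-trinomial : ∀ k m r → ((k ℕ.+ r) C k) ℕ.* ((k ℕ.+ m) C (k ℕ.+ r)) ≡ ((k ℕ.+ m) C k) ℕ.* (m C r)
  C-trinomial k m r with r ℕ.≤? m
  ... | no r≰m = begin
    ((k ℕ.+ r) C k) ℕ.* ((k ℕ.+ m) C (k ℕ.+ r))
      ≡⟨ cong (((k ℕ.+ r) C k) ℕ.*_) (k>n⇒nCk≡0 (ℕ.+-monoʳ-< k (ℕ.≰⇒> r≰m))) ⟩
    ((k ℕ.+ r) C k) ℕ.* 0
      ≡⟨ trans (ℕ.*-zeroʳ ((k ℕ.+ r) C k)) (sym (ℕ.*-zeroʳ ((k ℕ.+ m) C k))) ⟩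
    ((k ℕ.+ m) C k) ℕ.* 0
      ≡⟨ cong (((k ℕ.+ m) C k) ℕ.*_) (sym (k>n⇒nCk≡0 (ℕ.≰⇒> r≰m))) ⟩
    ((k ℕ.+ m) C k) ℕ.* (m C r) ∎
  ... | yes r≤m with ℕ.m≤n⇒∃[o]m+o≡n r≤m
  ...   | e , refl = ℕ.*-cancelʳ-≡ _ _ (k ! ℕ.* (r ! ℕ.* e !)) {{nz}} (begin
    c₁ ℕ.* c₂ ℕ.* (k ! ℕ.* (r ! ℕ.* e !))
      ≡⟨ rearrange₁ c₁ c₂ (k !) (r !) (e !) ⟩
    c₂ ℕ.* (c₁ ℕ.* (k ! ℕ.* r !) ℕ.* e !)
      ≡⟨ cong (λ z → c₂ ℕ.* (z ℕ.* e !)) (C-factorial-+ k r) ⟩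
    c₂ ℕ.* ((k ℕ.+ r) ! ℕ.* e !)
      ≡⟨ cong (λ n → (n C (k ℕ.+ r)) ℕ.* ((k ℕ.+ r) ! ℕ.* e !)) (sym (ℕ.+-assoc k r e)) ⟩
    ((k ℕ.+ r ℕ.+ e) C (k ℕ.+ r)) ℕ.* ((k ℕ.+ r) ! ℕ.* e !)
      ≡⟨ C-factorial-+ (k ℕ.+ r) e ⟩
    (k ℕ.+ r ℕ.+ e) !
      ≡⟨ cong _! (ℕ.+-assoc k r e) ⟩
    (k ℕ.+ (r ℕ.+ e)) !
      ≡⟨ sym (C-factorial-+ k (r ℕ.+ e)) ⟩
    c₃ ℕ.* (k ! ℕ.* (r ℕ.+ e) !)
      ≡⟨ cong (λ z → c₃ ℕ.* (k ! ℕ.* z)) (sym (C-factorial-+ r e)) ⟩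
    c₃ ℕ.* (k ! ℕ.* (c₄ ℕ.* (r ! ℕ.* e !)))
      ≡⟨ rearrange₂ c₃ c₄ (k !) (r !) (e !) ⟩
    c₃ ℕ.* c₄ ℕ.* (k ! ℕ.* (r ! ℕ.* e !)) ∎)
    where
    open NatSolver.+-*-Solver
    c₁ = (k ℕ.+ r) C k
    c₂ = (k ℕ.+ (r ℕ.+ e)) C (k ℕ.+ r)
    c₃ = (k ℕ.+ (r ℕ.+ e)) C k
    c₄ = (r ℕ.+ e) C r
    nz = ℕ.m*n≢0 (k !) (r ! ℕ.* e !) {{k ℕ.!≢0}} {{r ℕ.!* e !≢0}}
    rearrange₁ = solve 5 (λ a b k r e → a :* b :* (k :* (r :* e)) := b :* (a :* (k :* r) :* e)) refl
    rearrange₂ = solve 5 (λ a b k r e → a :* (k :* (b :* (r :* e))) := a :* b :* (k :* (r :* e))) refl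

  Σ : ℕ → (ℕ → ℤ) → ℤ
  Σ zero    f = 0ℤ
  Σ (suc n) f = Σ n f + f n

  Σ-cong : ∀ n {f g} → (∀ r → r < n → f r ≡ g r) → Σ n f ≡ Σ n g
  Σ-cong zero    e = refl
  Σ-cong (suc n) e = cong₂ _+_ (Σ-cong n λ r p → e r (ℕ.m<n⇒m<1+n p)) (e n ℕ.≤-refl)

  Σ-zero : ∀ n {f} → (∀ r → r < n → f r ≡ 0ℤ) → Σ n f ≡ 0ℤ
  Σ-zero zero    e = refl
  Σ-zero (suc n) e = cong₂ _+_ (Σ-zero n λ r p → e r (ℕ.m<n⇒m<1+n p)) (e n ℕ.≤-refl)

  Σ-split : ∀ k m f → Σ (k ℕ.+ m) f ≡ Σ k f + Σ m (λ r → f (k ℕ.+ r))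
  Σ-split k zero    f = trans (cong (λ n → Σ n f) (ℕ.+-identityʳ k)) (sym (ℤ.+-identityʳ _))
  Σ-split k (suc m) f = begin
    Σ (k ℕ.+ suc m) f                                    ≡⟨ cong (λ n → Σ n f) (ℕ.+-suc k m) ⟩
    Σ (k ℕ.+ m) f + f (k ℕ.+ m)                          ≡⟨ cong (_+ f (k ℕ.+ m)) (Σ-split k m f) ⟩
    Σ k f + Σ m (λ r → f (k ℕ.+ r)) + f (k ℕ.+ m)        ≡⟨ ℤ.+-assoc (Σ k f) _ _ ⟩
    Σ k f + (Σ m (λ r → f (k ℕ.+ r)) + f (k ℕ.+ m))      ∎

  Σ-* : ∀ n c f → Σ n (λ r → c * f r) ≡ c * Σ n f
  Σ-* zero    c f = sym (ℤ.*-zeroʳ c)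
  Σ-* (suc n) c f = trans (cong (_+ c * f n) (Σ-* n c f)) (sym (ℤ.*-distribˡ-+ c (Σ n f) (f n)))

  -- The value at n of the integer-valued polynomial with Newton coefficients a.
  val : (ℕ → ℤ) → ℕ → ℤ
  val a n = Σ (suc n) (λ r → a r * + (n C r))

  infixl 6 _⊖2_⊖_
  -- The cutting rule solved for one pattern. The middle term belongs to x00y, which has one peak
  -- fewer and therefore twice the power of two.
  _⊖2_⊖_ : (ℕ → ℤ) → (ℕ → ℤ) → (ℕ → ℤ) → ℕ → ℤ
  (a ⊖2 b ⊖ c) r = a r - + 2 * b r - c r

  val-⊖ : ∀ a b c n → val (a ⊖2 b ⊖ c) n ≡ val a n - + 2 * val b n - val c n
  val-⊖ a b c n = go (suc n)
    where
    open +-*-Solver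
    go : ∀ k → Σ k (λ r → (a ⊖2 b ⊖ c) r * + (n C r)) ≡
      Σ k (λ r → a r * + (n C r)) - + 2 * Σ k (λ r → b r * + (n C r)) - Σ k (λ r → c r * + (n C r))
    go zero    = refl
    go (suc k) = trans (cong (_+ (a ⊖2 b ⊖ c) k * + (n C k)) (go k))
      (solve 7 (λ s t u a b c d → s :- con (+ 2) :* t :- u :+ (a :- con (+ 2) :* b :- c) :* d
          := s :+ a :* d :- con (+ 2) :* (t :+ b :* d) :- (u :+ c :* d)) refl
        (Σ k (λ r → a r * + (n C r))) (Σ k (λ r → b r * + (n C r))) (Σ k (λ r → c r * + (n C r)))
        (a k) (b k) (c k) (+ (n C k)))

  val-zero : ∀ n → val (λ _ → 0ℤ) n ≡ 0ℤ
  val-zero n = Σ-zero (suc n) λ r _ → refl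

  pad : ℕ → (ℕ → ℤ) → ℕ → ℤ
  pad zero    q r       = q r
  pad (suc k) q zero    = 0ℤ
  pad (suc k) q (suc r) = pad k q r

  pad-< : ∀ k q r → r < k → pad k q r ≡ 0ℤ
  pad-< (suc k) q zero    _       = refl
  pad-< (suc k) q (suc r) (s≤s p) = pad-< k q r p

  pad-+ : ∀ k q r → pad k q (k ℕ.+ r) ≡ q r
  pad-+ zero    q r = refl
  pad-+ (suc k) q r = pad-+ k q r

  pad-deg : ∀ k q d → (∀ r → d < r → q r ≡ 0ℤ) → ∀ r → k ℕ.+ d < r → pad k q r ≡ 0ℤ
  pad-deg zero    q d e r       p       = e r p
  pad-deg (suc k) q d e (suc r) (s≤s p) = pad-deg k q d e r p

  -- The Newton coefficients of c · (x choose k) · q(x - k), by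
  -- (x choose k)(x-k choose r) = (k+r choose k)(x choose k+r).
  binomialTimes : ℕ → ℤ → (ℕ → ℤ) → ℕ → ℤ
  binomialTimes k c q = pad k (λ r → c * q r * + ((k ℕ.+ r) C k))

  val-binomialTimes : ∀ k c q m →
    val (binomialTimes k c q) (k ℕ.+ m) ≡ c * + ((k ℕ.+ m) C k) * val q m
  val-binomialTimes k c q m = begin
    Σ (suc (k ℕ.+ m)) f
      ≡⟨ cong (λ n → Σ n f) (sym (ℕ.+-suc k m)) ⟩
    Σ (k ℕ.+ suc m) f
      ≡⟨ Σ-split k (suc m) f ⟩
    Σ k f + Σ (suc m) (λ r → f (k ℕ.+ r))
      ≡⟨ cong₂ _+_ (Σ-zero k λ r p → cong (_* + ((k ℕ.+ m) C r)) (pad-< k _ r p)) (Σ-cong (suc m) λ r _ → term r) ⟩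
    0ℤ + Σ (suc m) (λ r → c * + ((k ℕ.+ m) C k) * (q r * + (m C r)))
      ≡⟨ ℤ.+-identityˡ _ ⟩
    Σ (suc m) (λ r → c * + ((k ℕ.+ m) C k) * (q r * + (m C r)))
      ≡⟨ Σ-* (suc m) (c * + ((k ℕ.+ m) C k)) (λ r → q r * + (m C r)) ⟩
    c * + ((k ℕ.+ m) C k) * val q m ∎
    where
    open +-*-Solver
    f : ℕ → ℤ
    f r = binomialTimes k c q r * + ((k ℕ.+ m) C r)
    term : ∀ r → f (k ℕ.+ r) ≡ c * + ((k ℕ.+ m) C k) * (q r * + (m C r))
    term r = begin
      f (k ℕ.+ r)
        ≡⟨ cong (_* + ((k ℕ.+ m) C (k ℕ.+ r))) (pad-+ k _ r) ⟩
      c * q r * + ((k ℕ.+ r) C k) * + ((k ℕ.+ m) C (k ℕ.+ r))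
        ≡⟨ ℤ.*-assoc (c * q r) _ _ ⟩
      c * q r * (+ ((k ℕ.+ r) C k) * + ((k ℕ.+ m) C (k ℕ.+ r)))
        ≡⟨ cong (c * q r *_) (trans (sym (ℤ.pos-* ((k ℕ.+ r) C k) _))
             (trans (cong +_ (C-trinomial k m r)) (ℤ.pos-* ((k ℕ.+ m) C k) (m C r)))) ⟩
      c * q r * (+ ((k ℕ.+ m) C k) * + (m C r))
        ≡⟨ solve 4 (λ c q a b → c :* q :* (a :* b) := c :* a :* (q :* b)) refl
             c (q r) (+ ((k ℕ.+ m) C k)) (+ (m C r)) ⟩
      c * + ((k ℕ.+ m) C k) * (q r * + (m C r)) ∎

  binomialTimes-deg : ∀ k c q d → (∀ r → d < r → q r ≡ 0ℤ) →
    ∀ r → k ℕ.+ d < r → binomialTimes k c q r ≡ 0ℤ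
  binomialTimes-deg k c q d e = pad-deg k _ d λ r p →
    cong (_* + ((k ℕ.+ r) C k)) (trans (cong (c *_) (e r p)) (ℤ.*-zeroʳ c))

  *-≢0 : ∀ {i j} → i ≢ 0ℤ → j ≢ 0ℤ → i * j ≢ 0ℤ
  *-≢0 {i} i≢0 j≢0 e with ℤ.i*j≡0⇒i≡0∨j≡0 i e
  ... | inj₁ p = i≢0 p
  ... | inj₂ p = j≢0 p

  binomialTimes-lead : ∀ k c q d → c ≢ 0ℤ → q d ≢ 0ℤ → binomialTimes k c q (k ℕ.+ d) ≢ 0ℤ
  binomialTimes-lead k c q d c≢0 q≢0 e = *-≢0 (*-≢0 c≢0 q≢0) (λ p → C-≢0 k d (ℤ.+-injective p))
    (trans (sym (pad-+ k _ d)) e)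

  one : ℕ → ℤ
  one zero    = 1ℤ
  one (suc r) = 0ℤ

  val-one : ∀ n → val one n ≡ 1ℤ
  val-one n = trans (Σ-split 1 n _) (cong (λ z → 1ℤ + z) (Σ-zero n λ r _ → refl))

  -- The recursion for the polynomials of the patterns

  ♯ : List Bool → ℕ
  ♯ []          = 0
  ♯ (true ∷ P)  = suc (♯ P)
  ♯ (false ∷ P) = ♯ P

  -- Newton coefficients of the polynomial of the patterns 0…0Y (right Y) and 0…01y
  -- (right₁ y), and of R̄0…0Y (left R Y) and R̄10…0Y (left₁ R Y), where R̄ is R reversed.
  right right₁ : List Bool → ℕ → ℤ
  right []            = one
  right (false ∷ Y)   = right Y
  right (true ∷ y)    = right₁ y
  right₁ []           = λ _ → 0ℤ
  right₁ (true ∷ y)   = λ _ → 0ℤ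
  -- The half 0y has fixed length, so its polynomial enters as a constant; the other half, all
  -- zeros, has the polynomial 1.
  right₁ (false ∷ y)  =
    binomialTimes (suc (length y)) (val (right y) (suc (length y))) one ⊖2 right y ⊖ right₁ y

  left left₁ : List Bool → List Bool → ℕ → ℤ
  left []            Y = right Y
  left (false ∷ R)   Y = left R Y
  left (true ∷ R)    Y = left₁ R Y
  left₁ []           Y = λ _ → 0ℤ
  left₁ (true ∷ R)   Y = λ _ → 0ℤ
  -- Now the left half R̄0 has fixed length and gives the constant, while the right half 0...0Y
  -- contributes `right Y`, shifted by that length.
  left₁ (false ∷ R)  Y =
    binomialTimes (suc (length R)) (val (left R []) (suc (length R))) (right Y) ⊖2 left R Y ⊖ left₁ R Y

  -- N P = val a n · 2 ^ (n - c - 1) for n the length of P, without the subtraction.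
  record CountedBy (a : ℕ → ℤ) (P : List Bool) (c : ℕ) : Set where
    constructor counted
    field equation : + N P * + (2 ^ suc c) ≡ val a (length P) * + (2 ^ length P)

  open CountedBy

  zeros : ℕ → List Bool → List Bool
  zeros m Y = replicate m false ++ Y

  zeros-suc : ∀ m Y → zeros m (false ∷ Y) ≡ zeros (suc m) Y
  zeros-suc zero    Y = refl
  zeros-suc (suc m) Y = cong (false ∷_) (zeros-suc m Y)

  CountedBy-zero : ∀ P c → N P ≡ 0 → CountedBy (λ _ → 0ℤ) P c
  CountedBy-zero P c e = counted (trans (cong (λ z → + z * + (2 ^ suc c)) e)
    (sym (cong (_* + (2 ^ length P)) (val-zero (length P)))))

  pos-2^suc : ∀ c → + (2 ^ suc c) ≡ + 2 * + (2 ^ c)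
  pos-2^suc c = ℤ.pos-* 2 (2 ^ c)

  pos-2^+ : ∀ k l → + (2 ^ (k ℕ.+ l)) ≡ + (2 ^ k) * + (2 ^ l)
  pos-2^+ k l = trans (cong +_ (ℕ.^-distribˡ-+-* 2 k l)) (ℤ.pos-* (2 ^ k) (2 ^ l))

  -- The cutting rule for polynomials: from the two halves and x00y, each of x10y and x01y
  -- determines the other. Working with products instead of quotients by powers of two keeps
  -- truncated subtraction out of the computation.
  module _ (x y : List Bool) (α β : ℕ) {a b p₀ : ℕ → ℤ}
    (A : CountedBy a (x ++ false ∷ []) α) (B : CountedBy b (false ∷ y) β)
    (P₀ : CountedBy p₀ (x ++ false ∷ false ∷ y) (α ℕ.+ β)) where

    private
      open +-*-Solver
      k = length (x ++ false ∷ [])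
      l = suc (length y)
      n = k ℕ.+ l
      s = α ℕ.+ β
      T = + (2 ^ n)
      t = + (2 ^ suc s)
      n₀₀ = + N (x ++ false ∷ false ∷ y)
      n₁₀ = + N (x ++ true ∷ false ∷ y)
      n₀₁ = + N (x ++ false ∷ true ∷ y)
      u = + N (x ++ false ∷ [])
      v = + N (false ∷ y)

      resize : ∀ {d e : Bool} (p : ℕ → ℤ) →
        val p (length (x ++ d ∷ e ∷ y)) * + (2 ^ length (x ++ d ∷ e ∷ y)) ≡ val p n * T
      resize p = cong (λ j → val p j * + (2 ^ j)) (length-pair x)

      total : n₀₀ + n₁₀ + n₀₁ ≡ + (n C k) * (u * v)
      total = trans (cong +_ (N-split x y)) (trans (ℤ.pos-* (n C k) _)
        (cong (+ (n C k) *_) (ℤ.pos-* (N (x ++ false ∷ [])) (N (false ∷ y)))))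

      product : u * v * (+ 2 * t) ≡ val a k * val b l * T
      product = begin
        u * v * (+ 2 * t)
          ≡⟨ cong (λ z → u * v * (+ 2 * z)) (trans (pos-2^suc s) (cong (+ 2 *_) (pos-2^+ α β))) ⟩
        u * v * (+ 2 * (+ 2 * (+ (2 ^ α) * + (2 ^ β))))
          ≡⟨ solve 4 (λ u v p q → u :* v :* (con (+ 2) :* (con (+ 2) :* (p :* q)))
               := (u :* (con (+ 2) :* p)) :* (v :* (con (+ 2) :* q))) refl u v (+ (2 ^ α)) (+ (2 ^ β)) ⟩
        (u * (+ 2 * + (2 ^ α))) * (v * (+ 2 * + (2 ^ β)))
          ≡⟨ cong₂ (λ p q → (u * p) * (v * q)) (sym (pos-2^suc α)) (sym (pos-2^suc β)) ⟩
        (u * + (2 ^ suc α)) * (v * + (2 ^ suc β))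
          ≡⟨ cong₂ _*_ (equation A) (equation B) ⟩
        (val a k * + (2 ^ k)) * (val b l * + (2 ^ l))
          ≡⟨ solve 4 (λ a p b q → (a :* p) :* (b :* q) := a :* b :* (p :* q)) refl
               (val a k) (+ (2 ^ k)) (val b l) (+ (2 ^ l)) ⟩
        val a k * val b l * (+ (2 ^ k) * + (2 ^ l))
          ≡⟨ cong (val a k * val b l *_) (sym (pos-2^+ k l)) ⟩
        val a k * val b l * T ∎

      -- The patterns x10y and x01y play symmetric roles: n₁ is the count sought and n₂ the one
      -- already known.
      solveFor : ∀ {n₁ n₂ p₂} → n₁ ≡ + (n C k) * (u * v) - n₀₀ - n₂ →
        n₂ * + (2 ^ suc (suc s)) ≡ p₂ * T →
        n₁ * + (2 ^ suc (suc s)) ≡ (+ (n C k) * (val a k * val b l) - + 2 * val p₀ n - p₂) * T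
      solveFor {n₁} {n₂} {p₂} e h = begin
        n₁ * + (2 ^ suc (suc s))
          ≡⟨ cong₂ _*_ e (pos-2^suc (suc s)) ⟩
        (+ (n C k) * (u * v) - n₀₀ - n₂) * (+ 2 * t)
          ≡⟨ solve 5 (λ c w z y t → (c :* w :- z :- y) :* (con (+ 2) :* t)
               := c :* (w :* (con (+ 2) :* t)) :- con (+ 2) :* (z :* t) :- y :* (con (+ 2) :* t)) refl
               (+ (n C k)) (u * v) n₀₀ n₂ t ⟩
        + (n C k) * (u * v * (+ 2 * t)) - + 2 * (n₀₀ * t) - n₂ * (+ 2 * t)
          ≡⟨ cong₂ _-_ (cong₂ _-_ (cong (+ (n C k) *_) product) (cong (+ 2 *_) (trans (equation P₀) (resize p₀))))
               (trans (cong (n₂ *_) (sym (pos-2^suc (suc s)))) h) ⟩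
        + (n C k) * (val a k * val b l * T) - + 2 * (val p₀ n * T) - p₂ * T
          ≡⟨ solve 5 (λ c w z y t → c :* (w :* t) :- con (+ 2) :* (z :* t) :- y :* t
               := (c :* w :- con (+ 2) :* z :- y) :* t) refl (+ (n C k)) (val a k * val b l) (val p₀ n) p₂ T ⟩
        (+ (n C k) * (val a k * val b l) - + 2 * val p₀ n - p₂) * T ∎

    CountedBy-01 : ∀ {p₁₀ p₀₁} → CountedBy p₁₀ (x ++ true ∷ false ∷ y) (suc s) →
      val p₀₁ n ≡ + (n C k) * (val a k * val b l) - + 2 * val p₀ n - val p₁₀ n →
      CountedBy p₀₁ (x ++ false ∷ true ∷ y) (suc s)
    CountedBy-01 {p₁₀} {p₀₁} h e = counted (trans
      (solveFor (trans (solve 3 (λ a b c → c := a :+ b :+ c :- a :- b) refl n₀₀ n₁₀ n₀₁)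
                  (cong (λ z → z - n₀₀ - n₁₀) total))
        (trans (equation h) (resize p₁₀)))
      (trans (cong (_* T) (sym e)) (sym (resize p₀₁))))

    CountedBy-10 : ∀ {p₁₀ p₀₁} → CountedBy p₀₁ (x ++ false ∷ true ∷ y) (suc s) →
      val p₁₀ n ≡ + (n C k) * (val a k * val b l) - + 2 * val p₀ n - val p₀₁ n →
      CountedBy p₁₀ (x ++ true ∷ false ∷ y) (suc s)
    CountedBy-10 {p₁₀} {p₀₁} h e = counted (trans
      (solveFor (trans (solve 3 (λ a b c → b := a :+ b :+ c :- a :- c) refl n₀₀ n₁₀ n₀₁)
                  (cong (λ z → z - n₀₀ - n₀₁) total))
        (trans (equation h) (resize p₀₁)))
      (trans (cong (_* T) (sym e)) (sym (resize p₁₀))))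

  -- All gap lengths are handled at once, because the other patterns in the cutting rule trade a
  -- shorter Y for a longer gap. One zero is always kept, since for the empty pattern the equation
  -- with `one` would read 2 = 1.
  right-counts : ∀ Y m → CountedBy (right Y) (zeros (suc m) Y) (♯ Y)
  right₁-counts : ∀ y m → CountedBy (right₁ y) (zeros (suc m) (true ∷ y)) (suc (♯ y))

  right-counts [] m = subst (λ P → CountedBy one P 0) (sym (++-identityʳ (replicate (suc m) false))) (counted (begin
    + N (replicate (suc m) false) * + 2
      ≡⟨ cong (λ z → + z * + 2) (N-flat m) ⟩
    + (2 ^ m) * + 2
      ≡⟨ trans (ℤ.*-comm (+ (2 ^ m)) (+ 2)) (sym (pos-2^suc m)) ⟩
    + (2 ^ suc m)
      ≡⟨ cong (λ k → + (2 ^ k)) (sym (length-replicate (suc m))) ⟩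
    + (2 ^ length (replicate (suc m) false))
      ≡⟨ sym (ℤ.*-identityˡ _) ⟩
    1ℤ * + (2 ^ length (replicate (suc m) false))
      ≡⟨ cong (_* + (2 ^ length (replicate (suc m) false))) (sym (val-one (length (replicate (suc m) false)))) ⟩
    val one (length (replicate (suc m) false)) * + (2 ^ length (replicate (suc m) false)) ∎))
  right-counts (false ∷ Y) m =
    subst (λ P → CountedBy (right Y) P (♯ Y)) (sym (zeros-suc (suc m) Y)) (right-counts Y (suc m))
  right-counts (true ∷ y)  m = right₁-counts y m

  right₁-counts []         m = CountedBy-zero _ 1 (N-end-true (replicate (suc m) false))
  right₁-counts (true ∷ y) m = CountedBy-zero _ _ (N-adjacent (replicate (suc m) false) y)
  right₁-counts (false ∷ y) m = CountedBy-10 x y 0 (♯ y) {a = one} {b = right y} {p₀ = right y}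
    (subst (λ P → CountedBy one P 0) (sym x0) (right-counts [] (suc m)))
    (right-counts y 0)
    (subst (λ P → CountedBy (right y) P (♯ y)) (sym (trans (zeros-suc (suc m) _) (zeros-suc (suc (suc m)) y)))
      (right-counts y (suc (suc m))))
    {p₀₁ = right₁ y}
    (subst (λ P → CountedBy (right₁ y) P (suc (♯ y))) (sym (zeros-suc (suc m) (true ∷ y))) (right₁-counts y (suc m)))
    (begin
      val (right₁ (false ∷ y)) (k ℕ.+ l)
        ≡⟨ val-⊖ (binomialTimes l c one) (right y) (right₁ y) (k ℕ.+ l) ⟩
      val (binomialTimes l c one) (k ℕ.+ l) - + 2 * val (right y) (k ℕ.+ l) - val (right₁ y) (k ℕ.+ l)
        ≡⟨ cong (λ z → z - + 2 * val (right y) (k ℕ.+ l) - val (right₁ y) (k ℕ.+ l)) (begin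
             val (binomialTimes l c one) (k ℕ.+ l)   ≡⟨ cong (val (binomialTimes l c one)) (ℕ.+-comm k l) ⟩
             val (binomialTimes l c one) (l ℕ.+ k)   ≡⟨ val-binomialTimes l c one k ⟩
             -- The polynomial was built from the fixed length l on the right, whereas the cutting
             -- rule chooses the k letters on the left.
             c * + ((l ℕ.+ k) C l) * val one k       ≡⟨ cong (λ z → c * + z * val one k) (C-comm l k) ⟩
             c * + ((k ℕ.+ l) C k) * val one k       ≡⟨ solve 3 (λ c b o → c :* b :* o := b :* (o :* c)) refl c _ _ ⟩
             + ((k ℕ.+ l) C k) * (val one k * c)     ∎) ⟩
      + ((k ℕ.+ l) C k) * (val one k * c) - + 2 * val (right y) (k ℕ.+ l) - val (right₁ y) (k ℕ.+ l) ∎)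
    where
    open +-*-Solver
    x = replicate (suc m) false
    x0 : x ++ false ∷ [] ≡ zeros (suc (suc m)) []
    x0 = zeros-suc (suc m) []
    k = length (x ++ false ∷ [])
    l = suc (length y)
    c = val (right y) l

  left-counts : ∀ R Y m → CountedBy (left R Y) (R ʳ++ zeros (suc m) Y) (♯ R ℕ.+ ♯ Y)
  left₁-counts : ∀ R Y m → CountedBy (left₁ R Y) (R ʳ++ true ∷ zeros (suc m) Y) (suc (♯ R ℕ.+ ♯ Y))

  left-counts []          Y m = right-counts Y m
  left-counts (false ∷ R) Y m = left-counts R Y (suc m)
  left-counts (true ∷ R)  Y m = left₁-counts R Y m

  left₁-counts []          Y m = CountedBy-zero _ _ (N-start-true (zeros (suc m) Y))
  left₁-counts (true ∷ R)  Y m = CountedBy-zero _ _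
    (trans (cong N (ʳ++-defn R)) (N-adjacent (reverse R) (zeros (suc m) Y)))
  left₁-counts (false ∷ R) Y m = subst (λ P → CountedBy (left₁ (false ∷ R) Y) P _) (sym (ʳ++-defn R))
    (CountedBy-01 x y (♯ R) (♯ Y) {a = left R []} {b = right Y} {p₀ = left R Y}
      -- The left half R̄0 is an instance of the same family, with a single zero and nothing behind
      -- it.
      (subst₂ (CountedBy (left R [])) (ʳ++-defn R) (ℕ.+-identityʳ (♯ R)) (left-counts R [] 0))
      (right-counts Y (suc m))
      (subst (λ P → CountedBy (left R Y) P _) (ʳ++-defn R) (left-counts R Y (suc (suc m))))
      {p₁₀ = left₁ R Y}
      (subst (λ P → CountedBy (left₁ R Y) P _) (ʳ++-defn R) (left₁-counts R Y (suc m)))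
      (begin
        val (left₁ (false ∷ R) Y) (k ℕ.+ l)
          ≡⟨ val-⊖ (binomialTimes j c (right Y)) (left R Y) (left₁ R Y) (k ℕ.+ l) ⟩
        val (binomialTimes j c (right Y)) (k ℕ.+ l) - + 2 * val (left R Y) (k ℕ.+ l) - val (left₁ R Y) (k ℕ.+ l)
          ≡⟨ cong (λ z → z - + 2 * val (left R Y) (k ℕ.+ l) - val (left₁ R Y) (k ℕ.+ l)) (begin
               val (binomialTimes j c (right Y)) (k ℕ.+ l)
                 ≡⟨ cong (λ j → val (binomialTimes j (val (left R []) j) (right Y)) (k ℕ.+ l)) j≡k ⟩
               val (binomialTimes k (val (left R []) k) (right Y)) (k ℕ.+ l)
                 ≡⟨ val-binomialTimes k (val (left R []) k) (right Y) l ⟩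
               val (left R []) k * + ((k ℕ.+ l) C k) * val (right Y) l
                 ≡⟨ solve 3 (λ c b o → c :* b :* o := b :* (c :* o)) refl (val (left R []) k) _ _ ⟩
               + ((k ℕ.+ l) C k) * (val (left R []) k * val (right Y) l) ∎) ⟩
        + ((k ℕ.+ l) C k) * (val (left R []) k * val (right Y) l) - + 2 * val (left R Y) (k ℕ.+ l) - val (left₁ R Y) (k ℕ.+ l) ∎))
    where
    open +-*-Solver
    x = reverse R
    y = zeros (suc m) Y
    k = length (x ++ false ∷ [])
    l = suc (length y)
    j = suc (length R)
    c = val (left R []) j
    j≡k : j ≡ k
    j≡k = trans (trans (ℕ.+-comm 1 (length R)) (sym (length-ʳ++ R)))
      (cong length (ʳ++-defn R {false ∷ []}))

  ⊖-vanishes : ∀ {a b c : ℕ → ℤ} r → a r ≡ 0ℤ → b r ≡ 0ℤ → c r ≡ 0ℤ → (a ⊖2 b ⊖ c) r ≡ 0ℤ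
  ⊖-vanishes r p q s rewrite p | q | s = refl

  -- Degrees and leading coefficients

  -- The binomial term alone can reach the bound; the two subtracted polynomials belong to a shorter
  -- Y and have strictly smaller bounds.
  right-deg : ∀ Y r → length Y ∸ 1 < r → right Y r ≡ 0ℤ
  right₁-deg : ∀ y r → length y < r → right₁ y r ≡ 0ℤ

  right-deg []          (suc r) _ = refl
  right-deg (false ∷ Y) r p = right-deg Y r (ℕ.≤-<-trans (ℕ.m∸n≤m (length Y) 1) p)
  right-deg (true ∷ y)  r p = right₁-deg y r p

  right₁-deg []          r p = refl
  right₁-deg (true ∷ y)  r p = refl
  right₁-deg (false ∷ y) r p = ⊖-vanishes
    {binomialTimes (suc (length y)) (val (right y) (suc (length y))) one} {right y} {right₁ y} r
    (binomialTimes-deg (suc (length y)) (val (right y) (suc (length y))) one 0 (λ { (suc r) _ → refl }) r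
      (subst (_< r) (sym (ℕ.+-identityʳ (suc (length y)))) p))
    (right-deg y r (ℕ.≤-<-trans (ℕ.m∸n≤m (length y) 1) (ℕ.<-trans (ℕ.n<1+n _) p)))
    (right₁-deg y r (ℕ.<-trans (ℕ.n<1+n _) p))

  left-deg : ∀ R Y r → (length R ∸ 1) ℕ.+ (length Y ∸ 1) < r → left R Y r ≡ 0ℤ
  left₁-deg : ∀ R Y r → length R ℕ.+ (length Y ∸ 1) < r → left₁ R Y r ≡ 0ℤ

  left-deg []          Y r p = right-deg Y r p
  left-deg (false ∷ R) Y r p = left-deg R Y r
    (ℕ.≤-<-trans (ℕ.+-monoˡ-≤ (length Y ∸ 1) (ℕ.m∸n≤m (length R) 1)) p)
  left-deg (true ∷ R)  Y r p = left₁-deg R Y r p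

  left₁-deg []          Y r p = refl
  left₁-deg (true ∷ R)  Y r p = refl
  left₁-deg (false ∷ R) Y r p = ⊖-vanishes
    {binomialTimes (suc (length R)) (val (left R []) (suc (length R))) (right Y)} {left R Y} {left₁ R Y} r
    (binomialTimes-deg (suc (length R)) (val (left R []) (suc (length R))) (right Y) (length Y ∸ 1) (right-deg Y) r p)
    (left-deg R Y r (ℕ.≤-<-trans (ℕ.+-monoˡ-≤ (length Y ∸ 1) (ℕ.m∸n≤m (length R) 1)) (ℕ.<-trans (ℕ.n<1+n _) p)))
    (left₁-deg R Y r (ℕ.<-trans (ℕ.n<1+n _) p))

  N≢0⇒val≢0 : ∀ {a} P c → CountedBy a P c → N P ≢ 0 → val a (length P) ≢ 0ℤ
  N≢0⇒val≢0 P c h N≢0 e = *-≢0 (λ q → N≢0 (ℤ.+-injective q))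
    (λ q → ℕ.≢-nonZero⁻¹ (2 ^ suc c) {{ℕ.m^n≢0 2 (suc c)}} (ℤ.+-injective q))
    (trans (equation h) (cong (_* + (2 ^ length P)) e))

  -- Counts are natural numbers, so if the product of the halves vanishes, so does every summand of
  -- the cutting rule. Read backwards, both halves of an admissible pattern are admissible, which
  -- makes the leading factors nonzero.
  N-cut-zeroˡ : ∀ x y → N (x ++ false ∷ []) ≡ 0 →
    N (x ++ true ∷ false ∷ y) ℕ.+ N (x ++ false ∷ true ∷ y) ≡ 0
  N-cut-zeroˡ x y e = ℕ.m+n≡0⇒n≡0 (N (x ++ false ∷ false ∷ y))
    (trans (sym (ℕ.+-assoc (N (x ++ false ∷ false ∷ y)) _ _))
    (trans (N-split x y) (trans (cong (λ z → c ℕ.* (z ℕ.* N (false ∷ y))) e) (ℕ.*-zeroʳ c))))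
    where c = (length (x ++ false ∷ []) ℕ.+ suc (length y)) C length (x ++ false ∷ [])

  N-cut-zeroʳ : ∀ x y → N (false ∷ y) ≡ 0 →
    N (x ++ true ∷ false ∷ y) ℕ.+ N (x ++ false ∷ true ∷ y) ≡ 0
  N-cut-zeroʳ x y e = ℕ.m+n≡0⇒n≡0 (N (x ++ false ∷ false ∷ y))
    (trans (sym (ℕ.+-assoc (N (x ++ false ∷ false ∷ y)) _ _))
    (trans (N-split x y) (trans (cong (λ z → c ℕ.* (N (x ++ false ∷ []) ℕ.* z)) e)
      (trans (cong (c ℕ.*_) (ℕ.*-zeroʳ (N (x ++ false ∷ [])))) (ℕ.*-zeroʳ c)))))
    where c = (length (x ++ false ∷ []) ℕ.+ suc (length y)) C length (x ++ false ∷ [])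

  ⊖-lead : ∀ {a b c : ℕ → ℤ} r → a r ≢ 0ℤ → b r ≡ 0ℤ → c r ≡ 0ℤ → (a ⊖2 b ⊖ c) r ≢ 0ℤ
  ⊖-lead {a} r p q s e rewrite q | s =
    p (trans (sym (trans (ℤ.+-identityʳ (a r + 0ℤ)) (ℤ.+-identityʳ (a r)))) e)

  right₁-lead : ∀ y m → N (zeros (suc m) (true ∷ y)) ≢ 0 → right₁ y (length y) ≢ 0ℤ
  right₁-lead []          m adm = contradiction (N-end-true (replicate (suc m) false)) adm
  right₁-lead (true ∷ y)  m adm = contradiction (N-adjacent (replicate (suc m) false) y) adm
  right₁-lead (false ∷ y) m adm = ⊖-lead
    {binomialTimes (suc (length y)) (val (right y) (suc (length y))) one} {right y} {right₁ y} l
    (subst (λ r → binomialTimes l (val (right y) l) one r ≢ 0ℤ) (ℕ.+-identityʳ l)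
      (binomialTimes-lead l (val (right y) l) one 0
        (N≢0⇒val≢0 {right y} (false ∷ y) (♯ y) (right-counts y 0)
          (λ e → adm (ℕ.m+n≡0⇒m≡0 _ (N-cut-zeroʳ (replicate (suc m) false) y e))))
        λ ()))
    (right-deg y l (ℕ.≤-<-trans (ℕ.m∸n≤m (length y) 1) (ℕ.n<1+n _)))
    (right₁-deg y l (ℕ.n<1+n _))
    where l = suc (length y)

  -- The leading coefficient of `right Y` enters as a factor; that it is nonzero is assumed here and
  -- supplied by `right-lead` for Y empty or beginning with a 1.
  left₁-lead : ∀ R Y m → N (R ʳ++ true ∷ zeros (suc m) Y) ≢ 0 →
    (∀ m → N (zeros (suc m) Y) ≢ 0 → right Y (length Y ∸ 1) ≢ 0ℤ) →
    left₁ R Y (length R ℕ.+ (length Y ∸ 1)) ≢ 0ℤ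
  left₁-lead []          Y m adm _ = contradiction (N-start-true (zeros (suc m) Y)) adm
  left₁-lead (true ∷ R)  Y m adm _ = contradiction
    (trans (cong N (ʳ++-defn R)) (N-adjacent (reverse R) (zeros (suc m) Y))) adm
  left₁-lead (false ∷ R) Y m adm h = ⊖-lead
    {binomialTimes (suc (length R)) (val (left R []) (suc (length R))) (right Y)} {left R Y} {left₁ R Y} (k ℕ.+ d)
    (binomialTimes-lead k (val (left R []) k) (right Y) d
      (subst (λ j → val (left R []) j ≢ 0ℤ) (trans (length-ʳ++ R) (ℕ.+-comm (length R) 1))
        (N≢0⇒val≢0 (R ʳ++ false ∷ []) _ (left-counts R [] 0)
          λ e → adm′ (ℕ.m+n≡0⇒n≡0 (N (x ++ true ∷ false ∷ y)) (N-cut-zeroˡ x y (trans (cong N (sym (ʳ++-defn R))) e)))))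
      (h (suc m) λ e → adm′ (ℕ.m+n≡0⇒n≡0 (N (x ++ true ∷ false ∷ y)) (N-cut-zeroʳ x y e))))
    (left-deg R Y (k ℕ.+ d) (ℕ.≤-<-trans (ℕ.+-monoˡ-≤ d (ℕ.m∸n≤m (length R) 1)) (ℕ.n<1+n _)))
    (left₁-deg R Y (k ℕ.+ d) (ℕ.n<1+n _))
    where
    k = suc (length R)
    d = length Y ∸ 1
    x = reverse R
    y = zeros (suc m) Y
    adm′ : N (x ++ false ∷ true ∷ y) ≢ 0
    adm′ e = adm (trans (cong N (ʳ++-defn R)) e)

-- From Newton coefficients to rational coefficients

module NewtonPolynomials where

  open import Defs
  open NewtonCoefficients using (Σ; Σ-cong; Σ-zero; Σ-split; val)
  open import Data.Nat as ℕ using (ℕ; zero; suc; _<_)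
  import Data.Nat.Properties as ℕ
  open import Data.Nat.Combinatorics using (_C_; nCk+nC[k+1]≡[n+1]C[k+1]; k>n⇒nCk≡0)
  open import Data.Integer as ℤ using (ℤ; +_; -[1+_]; 0ℤ; 1ℤ)
  import Data.Integer.Properties as ℤ
  open import Data.Rational using (ℚ; 0ℚ; 1ℚ; _+_; _*_; _-_; -_; _/_; fromℚᵘ)
  open import Data.Rational.Properties
  open import Data.Rational.Solver using (module +-*-Solver)
  open import Data.Rational.Unnormalised as ℚᵘ using (mkℚᵘ; *≡*)
  import Data.Rational.Unnormalised.Properties as ℚᵘ
  open import Data.Fin as Fin using (Fin; fromℕ)
  import Data.List as List
  open import Data.Product using (∃-syntax; _,_)
  open import Relation.Binary.PropositionalEquality
  open ≡-Reasoning

  -- The fraction z / 1 in `ℤtoℚ` is normalised by a gcd, which does not compute for a variable z.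
  -- Arithmetic is therefore transferred from unnormalised fractions.
  fromℚᵘ-+ : ∀ p q → fromℚᵘ (p ℚᵘ.+ q) ≡ fromℚᵘ p + fromℚᵘ q
  fromℚᵘ-+ p q = toℚᵘ-injective (ℚᵘ.≃-trans (toℚᵘ-fromℚᵘ (p ℚᵘ.+ q))
    (ℚᵘ.≃-trans (ℚᵘ.+-cong (ℚᵘ.≃-sym (toℚᵘ-fromℚᵘ p)) (ℚᵘ.≃-sym (toℚᵘ-fromℚᵘ q)))
      (ℚᵘ.≃-sym (toℚᵘ-homo-+ (fromℚᵘ p) (fromℚᵘ q)))))

  fromℚᵘ-* : ∀ p q → fromℚᵘ (p ℚᵘ.* q) ≡ fromℚᵘ p * fromℚᵘ q
  fromℚᵘ-* p q = toℚᵘ-injective (ℚᵘ.≃-trans (toℚᵘ-fromℚᵘ (p ℚᵘ.* q))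
    (ℚᵘ.≃-trans (ℚᵘ.*-cong (ℚᵘ.≃-sym (toℚᵘ-fromℚᵘ p)) (ℚᵘ.≃-sym (toℚᵘ-fromℚᵘ q)))
      (ℚᵘ.≃-sym (toℚᵘ-homo-* (fromℚᵘ p) (fromℚᵘ q)))))

  ℤtoℚ-+ : ∀ a b → ℤtoℚ (a ℤ.+ b) ≡ ℤtoℚ a + ℤtoℚ b
  ℤtoℚ-+ a b = trans
    (fromℚᵘ-cong {mkℚᵘ (a ℤ.+ b) 0} {mkℚᵘ a 0 ℚᵘ.+ mkℚᵘ b 0}
      (*≡* (cong (ℤ._* 1ℤ) (sym (cong₂ ℤ._+_ (ℤ.*-identityʳ a) (ℤ.*-identityʳ b))))))
    (fromℚᵘ-+ (mkℚᵘ a 0) (mkℚᵘ b 0))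

  ℤtoℚ-* : ∀ a b → ℤtoℚ (a ℤ.* b) ≡ ℤtoℚ a * ℤtoℚ b
  ℤtoℚ-* a b = fromℚᵘ-* (mkℚᵘ a 0) (mkℚᵘ b 0)

  ℤtoℚ-injective : ∀ {a b} → ℤtoℚ a ≡ ℤtoℚ b → a ≡ b
  ℤtoℚ-injective {a} {b} e with fromℚᵘ-injective {mkℚᵘ a 0} {mkℚᵘ b 0} e
  ... | *≡* q = ℤ.*-cancelʳ-≡ a b 1ℤ q

  recip : ℕ → ℚ
  recip r = 1ℤ / suc r

  recip-inverse : ∀ r → ℕtoℚ (suc r) * recip r ≡ 1ℚ
  recip-inverse r = trans (sym (fromℚᵘ-* (mkℚᵘ (+ suc r) 0) (mkℚᵘ 1ℤ r)))
    (fromℚᵘ-cong {mkℚᵘ (+ suc r) 0 ℚᵘ.* mkℚᵘ 1ℤ r} {mkℚᵘ 1ℤ 0} (*≡* (begin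
      (+ suc r ℤ.* 1ℤ) ℤ.* 1ℤ   ≡⟨ ℤ.*-identityʳ _ ⟩
      + suc r ℤ.* 1ℤ            ≡⟨ ℤ.*-identityʳ _ ⟩
      + suc r                   ≡⟨ cong +_ (sym (ℕ.+-identityʳ (suc r))) ⟩
      + (1 ℕ.* suc r)           ≡⟨ sym (ℤ.*-identityˡ _) ⟩
      1ℤ ℤ.* + (1 ℕ.* suc r)    ∎)))

  ℕtoℚ-suc : ∀ r → ℕtoℚ (suc r) ≡ 1ℚ + ℕtoℚ r
  ℕtoℚ-suc r = ℤtoℚ-+ 1ℤ (+ r)

  suc-cancelʳ : ∀ r {x y} → x * ℕtoℚ (suc r) ≡ y * ℕtoℚ (suc r) → x ≡ y
  suc-cancelʳ r {x} {y} e = begin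
    x                            ≡⟨ undo x ⟩
    x * ℕtoℚ (suc r) * recip r   ≡⟨ cong (_* recip r) e ⟩
    y * ℕtoℚ (suc r) * recip r   ≡⟨ sym (undo y) ⟩
    y                            ∎
    where
    undo : ∀ x → x ≡ x * ℕtoℚ (suc r) * recip r
    undo x = sym (trans (*-assoc x (ℕtoℚ (suc r)) (recip r))
      (trans (cong (x *_) (recip-inverse r)) (*-identityʳ x)))

  binom : ℕ → ℚ → ℚ
  binom zero    x = 1ℚ
  binom (suc r) x = binom r x * ((x - ℕtoℚ r) * recip r)

  binom-suc : ∀ r x → binom (suc r) x * ℕtoℚ (suc r) ≡ binom r x * (x - ℕtoℚ r)
  binom-suc r x = begin
    binom r x * ((x - ℕtoℚ r) * recip r) * ℕtoℚ (suc r)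
      ≡⟨ solve 4 (λ b y i s → b :* (y :* i) :* s := b :* y :* (s :* i)) refl
           (binom r x) (x - ℕtoℚ r) (recip r) (ℕtoℚ (suc r)) ⟩
    binom r x * (x - ℕtoℚ r) * (ℕtoℚ (suc r) * recip r)
      ≡⟨ trans (cong (binom r x * (x - ℕtoℚ r) *_) (recip-inverse r)) (*-identityʳ _) ⟩
    binom r x * (x - ℕtoℚ r) ∎
    where open +-*-Solver

  -- Multiplied by r + 1, the left side becomes (x + 1) * binom r x by the absorption identity
  -- `shifted`. The two identities are proved together: `shifted` at suc r rests on Pascal's rule at
  -- r.
  binom-pascal : ∀ r x → binom (suc r) (x + 1ℚ) ≡ binom (suc r) x + binom r x
  binom-pascal r x = suc-cancelʳ r (begin
    binom (suc r) (x + 1ℚ) * ℕtoℚ (suc r)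
      ≡⟨ binom-suc r (x + 1ℚ) ⟩
    binom r (x + 1ℚ) * (x + 1ℚ - ℕtoℚ r)
      ≡⟨ shifted r ⟩
    binom r x * (x + 1ℚ)
      ≡⟨ solve 3 (λ b x s → b :* (x :+ con 1ℚ) := b :* (x :- s) :+ b :* (con 1ℚ :+ s)) refl
           (binom r x) x (ℕtoℚ r) ⟩
    binom r x * (x - ℕtoℚ r) + binom r x * (1ℚ + ℕtoℚ r)
      ≡⟨ cong₂ _+_ (sym (binom-suc r x)) (cong (binom r x *_) (sym (ℕtoℚ-suc r))) ⟩
    binom (suc r) x * ℕtoℚ (suc r) + binom r x * ℕtoℚ (suc r)
      ≡⟨ sym (*-distribʳ-+ (ℕtoℚ (suc r)) (binom (suc r) x) (binom r x)) ⟩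
    (binom (suc r) x + binom r x) * ℕtoℚ (suc r) ∎)
    where
    open +-*-Solver
    shifted : ∀ r → binom r (x + 1ℚ) * (x + 1ℚ - ℕtoℚ r) ≡ binom r x * (x + 1ℚ)
    shifted zero    = cong (1ℚ *_) (+-identityʳ (x + 1ℚ))
    shifted (suc r) = begin
      binom (suc r) (x + 1ℚ) * (x + 1ℚ - ℕtoℚ (suc r))
        ≡⟨ cong₂ (λ b s → b * (x + 1ℚ - s)) (binom-pascal r x) (ℕtoℚ-suc r) ⟩
      (binom (suc r) x + binom r x) * (x + 1ℚ - (1ℚ + ℕtoℚ r))
        ≡⟨ solve 4 (λ b c x s → (b :+ c) :* (x :+ con 1ℚ :- (con 1ℚ :+ s))
             := b :* (x :- s) :+ c :* (x :- s)) refl (binom (suc r) x) (binom r x) x (ℕtoℚ r) ⟩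
      binom (suc r) x * (x - ℕtoℚ r) + binom r x * (x - ℕtoℚ r)
        ≡⟨ cong (λ z → binom (suc r) x * (x - ℕtoℚ r) + z)
             (trans (sym (binom-suc r x)) (cong (binom (suc r) x *_) (ℕtoℚ-suc r))) ⟩
      binom (suc r) x * (x - ℕtoℚ r) + binom (suc r) x * (1ℚ + ℕtoℚ r)
        ≡⟨ solve 3 (λ b x s → b :* (x :- s) :+ b :* (con 1ℚ :+ s) := b :* (x :+ con 1ℚ)) refl
             (binom (suc r) x) x (ℕtoℚ r) ⟩
      binom (suc r) x * (x + 1ℚ) ∎

  binom-at-0 : ∀ r → binom (suc r) 0ℚ ≡ 0ℚ
  binom-at-0 zero    = refl
  binom-at-0 (suc r) = trans (cong (_* ((0ℚ - ℕtoℚ (suc r)) * recip (suc r))) (binom-at-0 r))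
    (*-zeroˡ ((0ℚ - ℕtoℚ (suc r)) * recip (suc r)))

  binom-ℕ : ∀ r n → binom r (ℕtoℚ n) ≡ ℕtoℚ (n C r)
  binom-ℕ zero    n       = refl
  binom-ℕ (suc r) zero    = trans (binom-at-0 r) (cong ℕtoℚ (sym (k>n⇒nCk≡0 {0} {suc r} (ℕ.s≤s ℕ.z≤n))))
  binom-ℕ (suc r) (suc n) = begin
    binom (suc r) (ℕtoℚ (suc n))
      ≡⟨ cong (binom (suc r)) (trans (ℕtoℚ-suc n) (+-comm 1ℚ (ℕtoℚ n))) ⟩
    binom (suc r) (ℕtoℚ n + 1ℚ)
      ≡⟨ binom-pascal r (ℕtoℚ n) ⟩
    binom (suc r) (ℕtoℚ n) + binom r (ℕtoℚ n)
      ≡⟨ cong₂ _+_ (binom-ℕ (suc r) n) (binom-ℕ r n) ⟩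
    ℕtoℚ (n C suc r) + ℕtoℚ (n C r)
      ≡⟨ sym (ℤtoℚ-+ (+ (n C suc r)) (+ (n C r))) ⟩
    ℕtoℚ ((n C suc r) ℕ.+ (n C r))
      ≡⟨ cong ℕtoℚ (trans (ℕ.+-comm (n C suc r) (n C r)) (nCk+nC[k+1]≡[n+1]C[k+1] n r)) ⟩
    ℕtoℚ (suc n C suc r) ∎

  binom-backward : ∀ r x {y} → x + 1ℚ ≡ y → binom (suc r) x ≡ binom (suc r) y - binom r x
  binom-backward r x refl = trans
    (solve 2 (λ b c → b := b :+ c :- c) refl (binom (suc r) x) (binom r x))
    (cong (_- binom r x) (sym (binom-pascal r x)))
    where open +-*-Solver

  ℤtoℚ-difference : ∀ a b → ℤtoℚ a - ℤtoℚ b ≡ ℤtoℚ (a ℤ.- b)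
  ℤtoℚ-difference a b = trans (cong (λ z → ℤtoℚ a + z) neg) (sym (ℤtoℚ-+ a (ℤ.- b)))
    where
    neg : - ℤtoℚ b ≡ ℤtoℚ (ℤ.- b)
    neg = begin
      - ℤtoℚ b                              ≡⟨ sym (+-identityʳ _) ⟩
      - ℤtoℚ b + 0ℚ                         ≡⟨ cong (λ z → - ℤtoℚ b + ℤtoℚ z) (sym (ℤ.+-inverseʳ b)) ⟩
      - ℤtoℚ b + ℤtoℚ (b ℤ.+ ℤ.- b)         ≡⟨ cong (λ z → - ℤtoℚ b + z) (ℤtoℚ-+ b (ℤ.- b)) ⟩
      - ℤtoℚ b + (ℤtoℚ b + ℤtoℚ (ℤ.- b))    ≡⟨ solve 2 (λ x y → :- x :+ (x :+ y) := y) refl (ℤtoℚ b) _ ⟩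
      ℤtoℚ (ℤ.- b)                          ∎
      where open +-*-Solver

  -- Negative integers are reached by running Pascal's rule backwards: the value at z comes from the
  -- one at z + 1 and from a smaller r.
  binom-ℤ : ∀ r z → ∃[ m ] binom r (ℤtoℚ z) ≡ ℤtoℚ m
  binom-ℤ zero    z     = 1ℤ , refl
  binom-ℤ (suc r) (+ n) = + (n C suc r) , binom-ℕ (suc r) n
  binom-ℤ (suc r) -[1+ zero ] with binom-ℤ r -[1+ 0 ]
  ... | m , e = ℤ.- m , trans (binom-backward r (ℤtoℚ -[1+ 0 ]) {0ℚ} refl)
    (trans (cong₂ _-_ (binom-at-0 r) e) (trans (ℤtoℚ-difference 0ℤ m) (cong ℤtoℚ (ℤ.+-identityˡ (ℤ.- m)))))
  binom-ℤ (suc r) -[1+ suc n ] with binom-ℤ (suc r) -[1+ n ] | binom-ℤ r -[1+ suc n ]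
  ... | m₁ , e₁ | m₂ , e₂ = m₁ ℤ.- m₂ , trans
    (binom-backward r (ℤtoℚ -[1+ suc n ]) (sym (ℤtoℚ-+ -[1+ suc n ] 1ℤ)))
    (trans (cong₂ _-_ e₁ e₂) (ℤtoℚ-difference m₁ m₂))

  -- The body of `evalPoly` for any number of coefficients, so that recursion can end at the empty
  -- list.
  evalCoeffs : ∀ {n} → (Fin n → ℚ) → ℚ → ℚ
  evalCoeffs c x = List.foldr (λ a acc → a + x * acc) 0ℚ (List.tabulate c)

  -- The coefficients of u + (α + βx) · c(x).
  linearTimes : ∀ {n} → ℚ → ℚ → ℚ → (Fin n → ℚ) → Fin (suc n) → ℚ
  linearTimes {zero}  u α β c i           = u
  linearTimes {suc n} u α β c Fin.zero    = u + α * c Fin.zero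
  linearTimes {suc n} u α β c (Fin.suc i) = linearTimes (β * c Fin.zero) α β (λ j → c (Fin.suc j)) i

  eval-linearTimes : ∀ {n} u α β (c : Fin n → ℚ) x →
    evalCoeffs (linearTimes u α β c) x ≡ u + (α + β * x) * evalCoeffs c x
  eval-linearTimes {zero}  u α β c x =
    cong (λ z → u + z) (trans (*-zeroʳ x) (sym (*-zeroʳ (α + β * x))))
  eval-linearTimes {suc n} u α β c x = begin
    u + α * c₀ + x * evalCoeffs (linearTimes (β * c₀) α β c′) x
      ≡⟨ cong (λ z → u + α * c₀ + x * z) (eval-linearTimes (β * c₀) α β c′ x) ⟩
    u + α * c₀ + x * (β * c₀ + (α + β * x) * e)
      ≡⟨ solve 6 (λ u α β c x e → u :+ α :* c :+ x :* (β :* c :+ (α :+ β :* x) :* e)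
           := u :+ (α :+ β :* x) :* (c :+ x :* e)) refl u α β c₀ x e ⟩
    u + (α + β * x) * (c₀ + x * e) ∎
    where
    open +-*-Solver
    c₀ = c Fin.zero
    c′ : Fin n → ℚ
    c′ j = c (Fin.suc j)
    e = evalCoeffs c′ x

  linearTimes-last : ∀ {n} u α β (c : Fin (suc n) → ℚ) →
    linearTimes u α β c (fromℕ (suc n)) ≡ β * c (fromℕ n)
  linearTimes-last {zero}  u α β c = refl
  linearTimes-last {suc n} u α β c = linearTimes-last (β * c Fin.zero) α β (λ j → c (Fin.suc j))

  -- Horner's scheme for the Newton form:
  -- a_r + (x-r)/(r+1) · (a_{r+1} + (x-r-1)/(r+2) · (…)).
  newton : (ℕ → ℤ) → ℕ → (e : ℕ) → Fin (suc e) → ℚ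
  newton a r zero    = λ _ → ℤtoℚ (a r)
  newton a r (suc e) = linearTimes (ℤtoℚ (a r)) (- (ℕtoℚ r * recip r)) (recip r) (newton a (suc r) e)

  newtonSum : (ℕ → ℤ) → ℕ → ℕ → ℚ → ℚ
  newtonSum a r zero    x = ℤtoℚ (a r) * binom r x
  newtonSum a r (suc e) x = ℤtoℚ (a r) * binom r x + newtonSum a (suc r) e x

  -- The factor `binom r x` restores the linear factors that precede stage r of Horner's scheme; one
  -- more stage turns it into `binom (suc r) x`.
  eval-newton : ∀ a r e x → binom r x * evalCoeffs (newton a r e) x ≡ newtonSum a r e x
  eval-newton a r zero    x = begin
    binom r x * (ℤtoℚ (a r) + x * 0ℚ)
      ≡⟨ solve 3 (λ b a x → b :* (a :+ x :* con 0ℚ) := a :* b) refl (binom r x) (ℤtoℚ (a r)) x ⟩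
    ℤtoℚ (a r) * binom r x ∎
    where open +-*-Solver
  eval-newton a r (suc e) x = begin
    binom r x * evalCoeffs (newton a r (suc e)) x
      ≡⟨ cong (binom r x *_) (eval-linearTimes (ℤtoℚ (a r)) _ (recip r) (newton a (suc r) e) x) ⟩
    binom r x * (ℤtoℚ (a r) + (- (ℕtoℚ r * recip r) + recip r * x) * v)
      ≡⟨ solve 6 (λ b a s i x v → b :* (a :+ (:- (s :* i) :+ i :* x) :* v)
           := a :* b :+ b :* ((x :- s) :* i) :* v) refl (binom r x) (ℤtoℚ (a r)) (ℕtoℚ r) (recip r) x v ⟩
    ℤtoℚ (a r) * binom r x + binom (suc r) x * v
      ≡⟨ cong (λ z → ℤtoℚ (a r) * binom r x + z) (eval-newton a (suc r) e x) ⟩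
    newtonSum a r (suc e) x ∎
    where
    open +-*-Solver
    v = evalCoeffs (newton a (suc r) e) x

  -- Each stage multiplies the top coefficient by an invertible reciprocal, so it can vanish only
  -- together with the last Newton coefficient.
  newton-last : ∀ a r e → a (r ℕ.+ e) ≢ 0ℤ → newton a r e (fromℕ e) ≢ 0ℚ
  newton-last a r zero    a≢0 p = a≢0 (trans (cong a (ℕ.+-identityʳ r)) (ℤtoℚ-injective p))
  newton-last a r (suc e) a≢0 p = newton-last a (suc r) e
    (λ q → a≢0 (trans (cong a (ℕ.+-suc r e)) q))
    (begin
      v                                   ≡⟨ sym (*-identityˡ v) ⟩
      1ℚ * v                              ≡⟨ cong (_* v) (sym (recip-inverse r)) ⟩
      ℕtoℚ (suc r) * recip r * v          ≡⟨ *-assoc (ℕtoℚ (suc r)) (recip r) v ⟩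
      ℕtoℚ (suc r) * (recip r * v)        ≡⟨ cong (ℕtoℚ (suc r) *_)
        (trans (sym (linearTimes-last (ℤtoℚ (a r)) _ (recip r) (newton a (suc r) e))) p) ⟩
      ℕtoℚ (suc r) * 0ℚ                   ≡⟨ *-zeroʳ (ℕtoℚ (suc r)) ⟩
      0ℚ                                  ∎)
    where v = newton a (suc r) e (fromℕ e)

  newtonSum-ℤ : ∀ a r e z → ∃[ m ] newtonSum a r e (ℤtoℚ z) ≡ ℤtoℚ m
  newtonSum-ℤ a r zero z with binom-ℤ r z
  ... | m , p = a r ℤ.* m , trans (cong (ℤtoℚ (a r) *_) p) (sym (ℤtoℚ-* (a r) m))
  newtonSum-ℤ a r (suc e) z with newtonSum-ℤ a r zero z | newtonSum-ℤ a (suc r) e z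
  ... | m₁ , p₁ | m₂ , p₂ = m₁ ℤ.+ m₂ , trans (cong₂ _+_ p₁ p₂) (sym (ℤtoℚ-+ m₁ m₂))

  newtonSum-ℕ : ∀ a r e n →
    newtonSum a r e (ℕtoℚ n) ≡ ℤtoℚ (Σ (suc e) (λ k → a (r ℕ.+ k) ℤ.* + (n C (r ℕ.+ k))))
  newtonSum-ℕ a r zero    n = begin
    ℤtoℚ (a r) * binom r (ℕtoℚ n)                   ≡⟨ cong (ℤtoℚ (a r) *_) (binom-ℕ r n) ⟩
    ℤtoℚ (a r) * ℕtoℚ (n C r)                       ≡⟨ sym (ℤtoℚ-* (a r) (+ (n C r))) ⟩
    ℤtoℚ (a r ℤ.* + (n C r))                        ≡⟨ cong (λ k → ℤtoℚ (a k ℤ.* + (n C k))) (sym (ℕ.+-identityʳ r)) ⟩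
    ℤtoℚ (a (r ℕ.+ 0) ℤ.* + (n C (r ℕ.+ 0)))        ≡⟨ cong ℤtoℚ (sym (ℤ.+-identityˡ (a (r ℕ.+ 0) ℤ.* + (n C (r ℕ.+ 0))))) ⟩
    ℤtoℚ (0ℤ ℤ.+ a (r ℕ.+ 0) ℤ.* + (n C (r ℕ.+ 0))) ∎
  newtonSum-ℕ a r (suc e) n = begin
    newtonSum a r zero (ℕtoℚ n) + newtonSum a (suc r) e (ℕtoℚ n)
      ≡⟨ cong₂ _+_ (newtonSum-ℕ a r zero n) (newtonSum-ℕ a (suc r) e n) ⟩
    ℤtoℚ (Σ 1 f) + ℤtoℚ (Σ (suc e) (λ k → a (suc r ℕ.+ k) ℤ.* + (n C (suc r ℕ.+ k))))
      ≡⟨ sym (ℤtoℚ-+ (Σ 1 f) _) ⟩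
    ℤtoℚ (Σ 1 f ℤ.+ Σ (suc e) (λ k → a (suc r ℕ.+ k) ℤ.* + (n C (suc r ℕ.+ k))))
      ≡⟨ cong (λ z → ℤtoℚ (Σ 1 f ℤ.+ z)) (Σ-cong (suc e) λ k _ →
           cong (λ j → a j ℤ.* + (n C j)) (sym (ℕ.+-suc r k))) ⟩
    ℤtoℚ (Σ 1 f ℤ.+ Σ (suc e) (λ k → f (suc k)))
      ≡⟨ cong ℤtoℚ (sym (Σ-split 1 (suc e) f)) ⟩
    ℤtoℚ (Σ (suc (suc e)) f) ∎
    where
    f : ℕ → ℤ
    f k = a (r ℕ.+ k) ℤ.* + (n C (r ℕ.+ k))

  -- Both sums equal the one with d + n + 2 terms: beyond d the coefficients vanish, beyond n the
  -- binomial coefficients do.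
  val-truncate : ∀ a d n → (∀ r → d < r → a r ≡ 0ℤ) → Σ (suc d) (λ r → a r ℤ.* + (n C r)) ≡ val a n
  val-truncate a d n vanish = begin
    Σ (suc d) f                   ≡⟨ sym (extend (suc d) (suc n) λ r →
      cong (ℤ._* + (n C (suc d ℕ.+ r))) (vanish _ (ℕ.s≤s (ℕ.m≤m+n d r)))) ⟩
    Σ (suc d ℕ.+ suc n) f         ≡⟨ cong (λ k → Σ k f) (ℕ.+-comm (suc d) (suc n)) ⟩
    Σ (suc n ℕ.+ suc d) f         ≡⟨ extend (suc n) (suc d) (λ r → trans
      (cong (λ z → a (suc n ℕ.+ r) ℤ.* + z) (k>n⇒nCk≡0 (ℕ.s≤s (ℕ.m≤m+n n r)))) (ℤ.*-zeroʳ (a (suc n ℕ.+ r)))) ⟩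
    Σ (suc n) f                   ∎
    where
    f : ℕ → ℤ
    f r = a r ℤ.* + (n C r)
    extend : ∀ k m → (∀ r → f (k ℕ.+ r) ≡ 0ℤ) → Σ (k ℕ.+ m) f ≡ Σ k f
    extend k m e = trans (Σ-split k m f)
      (trans (cong (λ z → Σ k f ℤ.+ z) (Σ-zero m λ r _ → e r)) (ℤ.+-identityʳ _))

  newton-integerValued : ∀ a d → IntegerValued (newton a 0 d)
  newton-integerValued a d z with newtonSum-ℤ a 0 d z
  ... | m , p = m , trans (trans (sym (*-identityˡ _)) (eval-newton a 0 d (ℤtoℚ z))) p

  newton-val : ∀ a d → (∀ r → d < r → a r ≡ 0ℤ) → ∀ n → evalPoly (newton a 0 d) (ℕtoℚ n) ≡ ℤtoℚ (val a n)
  newton-val a d vanish n = begin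
    evalCoeffs (newton a 0 d) (ℕtoℚ n)            ≡⟨ sym (*-identityˡ _) ⟩
    1ℚ * evalCoeffs (newton a 0 d) (ℕtoℚ n)       ≡⟨ eval-newton a 0 d (ℕtoℚ n) ⟩
    newtonSum a 0 d (ℕtoℚ n)                      ≡⟨ newtonSum-ℕ a 0 d n ⟩
    ℤtoℚ (Σ (suc d) (λ r → a r ℤ.* + (n C r)))    ≡⟨ cong ℤtoℚ (val-truncate a d n vanish) ⟩
    ℤtoℚ (val a n)                                ∎

-- From filtered lists of words to sums over arrangements

module PermutationPatterns where

  open import Defs
  open Arrangements
  open PeakPatterns
  open NewtonCoefficients using (♯; zeros)
  open import Data.Nat using (ℕ; zero; suc; _+_; _*_; _∸_; _≤_; _<_; _<?_; z≤n; s≤s; s≤s⁻¹)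
  open import Data.Nat.Properties
  open import Data.Bool using (Bool; true; false; not; _∧_; if_then_else_)
  open import Data.Fin as Fin using (Fin; toℕ; fromℕ)
  import Data.Fin.Properties as Fin
  open import Data.List using (List; []; _∷_; _++_; _ʳ++_; length; map; filter; concatMap; allFin; applyUpTo; tabulate)
  open import Data.List.Properties using (length-ʳ++; length-tabulate; map-tabulate; tabulate-cong)
  open import Data.List.Membership.Propositional using (_∈_; _∉_)
  open import Data.List.Membership.Propositional.Properties using (∈-++⁺ˡ; ∈-++⁺ʳ; ∈-++⁻; ∈-map⁺; ∈-map⁻)
  open import Data.List.Relation.Unary.Any using (here; there)
  open import Data.List.Relation.Unary.Any.Properties using (reverseAcc⁺; reverseAcc⁻)
  open import Data.List.Relation.Unary.All as All using (All; []; _∷_)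
  open import Data.List.Relation.Unary.AllPairs using ([]; _∷_)
  open import Data.List.Relation.Unary.Unique.Propositional using (Unique)
  open import Data.List.Relation.Unary.Unique.Propositional.Properties using (allFin⁺; map⁺)
  import Data.List.Relation.Unary.Unique.DecPropositional as UDec
  open import Data.List.Relation.Binary.Subset.Propositional using (_⊆_)
  open import Data.List.Relation.Binary.Subset.DecPropositional _≟_ using (_⊆?_)
  open import Data.Vec using (Vec; []; _∷_; toList)
  open import Data.Product using (_×_; _,_; proj₁; proj₂)
  open import Data.Sum using (_⊎_; inj₁; inj₂)
  open import Data.Empty using (⊥-elim)
  open import Function using (_∘_; id)
  open import Relation.Nullary using (Dec; does; yes; no; contradiction; _×-dec_)
  open import Relation.Nullary.Decidable using (dec-true; dec-false; ¬?)
  open import Relation.Unary using (Decidable)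
  open import Relation.Binary using (DecidableEquality)
  open import Relation.Binary.PropositionalEquality
  open ≡-Reasoning

  private variable
    A B : Set

  sumOver : List A → (A → ℕ) → ℕ
  sumOver []       f = 0
  sumOver (x ∷ xs) f = f x + sumOver xs f

  sumOver-cong : (xs : List A) {f g : A → ℕ} → (∀ x → f x ≡ g x) → sumOver xs f ≡ sumOver xs g
  sumOver-cong []       e = refl
  sumOver-cong (x ∷ xs) e = cong₂ _+_ (e x) (sumOver-cong xs e)

  sumOver-++ : (xs ys : List A) (f : A → ℕ) → sumOver (xs ++ ys) f ≡ sumOver xs f + sumOver ys f
  sumOver-++ []       ys f = refl
  sumOver-++ (x ∷ xs) ys f = trans (cong (f x +_) (sumOver-++ xs ys f)) (sym (+-assoc (f x) _ _))

  sumOver-map : (φ : A → B) (xs : List A) (f : B → ℕ) → sumOver (map φ xs) f ≡ sumOver xs (f ∘ φ)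
  sumOver-map φ []       f = refl
  sumOver-map φ (x ∷ xs) f = cong (f (φ x) +_) (sumOver-map φ xs f)

  sumOver-concatMap : (φ : A → List B) (xs : List A) (f : B → ℕ) →
    sumOver (concatMap φ xs) f ≡ sumOver xs (λ x → sumOver (φ x) f)
  sumOver-concatMap φ []       f = refl
  sumOver-concatMap φ (x ∷ xs) f =
    trans (sumOver-++ (φ x) (concatMap φ xs) f) (cong (sumOver (φ x) f +_) (sumOver-concatMap φ xs f))

  sumOver-Sel : (xs : List A) (f : A → ℕ) → sumOver xs f ≡ Sel xs (λ x _ → f x)
  sumOver-Sel []       f = refl
  sumOver-Sel (x ∷ xs) f = cong (f x +_) (sumOver-Sel xs f)

  length-filter-sum : {P : A → Set} (P? : Decidable P) (xs : List A) →
    length (filter P? xs) ≡ sumOver xs (λ x → 𝟙 (does (P? x)))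
  length-filter-sum P? []       = refl
  length-filter-sum P? (x ∷ xs) with does (P? x)
  ... | true  = cong suc (length-filter-sum P? xs)
  ... | false = length-filter-sum P? xs

  Words : ℕ → List A → (List A → ℕ) → ℕ
  Words zero    xs f = f []
  Words (suc k) xs f = sumOver xs (λ x → Words k xs (λ w → f (x ∷ w)))

  Words-cong : ∀ k (xs : List A) {f g : List A → ℕ} → (∀ w → f w ≡ g w) → Words k xs f ≡ Words k xs g
  Words-cong zero    xs e = e []
  Words-cong (suc k) xs e = sumOver-cong xs λ x → Words-cong k xs λ w → e (x ∷ w)

  sumOver-* : ∀ c (xs : List A) (f : A → ℕ) → sumOver xs (λ x → c * f x) ≡ c * sumOver xs f
  sumOver-* c xs f = trans (sumOver-Sel xs _) (trans (Sel-* c xs _) (cong (c *_) (sym (sumOver-Sel xs f))))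

  Words-* : ∀ k c (xs : List A) (f : List A → ℕ) → Words k xs (λ w → c * f w) ≡ c * Words k xs f
  Words-* zero    c xs f = refl
  Words-* (suc k) c xs f = trans (sumOver-cong xs λ x → Words-* k c xs _) (sumOver-* c xs _)

  allWords-sum : ∀ m k (f : List (Fin m) → ℕ) →
    sumOver (allWords m k) (f ∘ toList) ≡ Words k (allFin m) f
  allWords-sum m zero    f = +-identityʳ _
  allWords-sum m (suc k) f = trans (sumOver-concatMap _ (allFin m) _)
    (sumOver-cong (allFin m) λ x → trans (sumOver-map (x ∷_) (allWords m k) _) (allWords-sum m k _))

  𝟙-∧ : ∀ a b → 𝟙 (a ∧ b) ≡ 𝟙 a * 𝟙 b
  𝟙-∧ true  b = sym (+-identityʳ (𝟙 b))
  𝟙-∧ false b = refl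

  module _ {A : Set} (_≈?_ : DecidableEquality A) where
    open UDec _≈?_ using (unique?)

    private
      differs : A → A → ℕ
      differs x y = 𝟙 (does (¬? (x ≈? y)))

      fresh : A → List A → ℕ
      fresh x w = 𝟙 (does (All.all? (λ y → ¬? (x ≈? y)) w))

      -- Expresses through sums alone that deleting x from xs leaves r, the form in which a sum over
      -- fresh letters uses it.
      Removal : A → List A → List A → Set
      Removal x xs r = ∀ G → sumOver xs (λ y → differs x y * G y) ≡ sumOver r G

      differs-≢ : ∀ {x y} → x ≢ y → differs x y ≡ 1
      differs-≢ {x} {y} ne = cong 𝟙 (dec-true (¬? (x ≈? y)) ne)

      differs-refl : ∀ x → differs x x ≡ 0
      differs-refl x = cong 𝟙 (dec-false (¬? (x ≈? x)) (λ ne → ne refl))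

      Removal-absent : ∀ x xs → All (x ≢_) xs → Removal x xs xs
      Removal-absent x []       []       G = refl
      Removal-absent x (y ∷ xs) (p ∷ ps) G =
        cong₂ _+_ (trans (cong (_* G y) (differs-≢ p)) (*-identityˡ (G y))) (Removal-absent x xs ps G)

    -- The transfer of `All` from xs to x and r is what lets the induction see that the skipped
    -- letter z differs from the selected one and from the rest.
    Sel-cong-Unique : ∀ xs {F G : A → List A → ℕ} → Unique xs →
      (∀ x r → Unique r → (∀ {P : A → Set} → All P xs → P x × All P r) → Removal x xs r → F x r ≡ G x r) →
      Sel xs F ≡ Sel xs G
    Sel-cong-Unique []       []       e = refl
    Sel-cong-Unique (z ∷ zs) (p ∷ ps) e = cong₂ _+_
      (e z zs ps (λ { (q ∷ qs) → q , qs })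
        (λ G → cong₂ _+_ (cong (_* G z) (differs-refl z)) (Removal-absent z zs p G)))
      (Sel-cong-Unique zs ps λ y r ur sub rem → e y (z ∷ r) (proj₂ (sub p) ∷ ur)
        (λ { (q ∷ qs) → proj₁ (sub qs) , q ∷ proj₂ (sub qs) })
        (λ G → cong₂ _+_ (trans (cong (_* G z) (differs-≢ λ y≡z → proj₁ (sub p) (sym y≡z))) (*-identityˡ (G z)))
          (rem G)))

    private
      Words-fresh : ∀ k x xs r → Removal x xs r → (g : List A → ℕ) →
        Words k xs (λ w → fresh x w * g w) ≡ Words k r g
      Words-fresh zero    x xs r rem g = +-identityʳ (g [])
      Words-fresh (suc k) x xs r rem g = begin
        sumOver xs (λ y → Words k xs (λ w → fresh x (y ∷ w) * g (y ∷ w)))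
          ≡⟨ sumOver-cong xs (λ y → trans
               (Words-cong k xs λ w → trans
                 (cong (_* g (y ∷ w)) (𝟙-∧ (does (¬? (x ≈? y))) _)) (*-assoc (differs x y) (fresh x w) _))
               (Words-* k (differs x y) xs _)) ⟩
        sumOver xs (λ y → differs x y * Words k xs (λ w → fresh x w * g (y ∷ w)))
          ≡⟨ rem (λ y → Words k xs (λ w → fresh x w * g (y ∷ w))) ⟩
        sumOver r (λ y → Words k xs (λ w → fresh x w * g (y ∷ w)))
          ≡⟨ sumOver-cong r (λ y → Words-fresh k x xs r rem (λ w → g (y ∷ w))) ⟩
        Words (suc k) r g ∎

    -- The test for distinct letters unfolds into freshness of the first letter and distinctness of
    -- the rest, which is drawing without replacement.
    Words-unique : ∀ k xs → Unique xs → (f : List A → ℕ) →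
      Words k xs (λ w → 𝟙 (does (unique? w)) * f w) ≡ Arr k xs f
    Words-unique zero    xs u f = +-identityʳ (f [])
    Words-unique (suc k) xs u f = begin
      sumOver xs (λ x → Words k xs (λ w → 𝟙 (does (unique? (x ∷ w))) * f (x ∷ w)))
        ≡⟨ sumOver-Sel xs _ ⟩
      Sel xs (λ x _ → Words k xs (λ w → 𝟙 (does (unique? (x ∷ w))) * f (x ∷ w)))
        ≡⟨ Sel-cong-Unique xs u (λ x r ur _ rem → begin
             Words k xs (λ w → 𝟙 (does (unique? (x ∷ w))) * f (x ∷ w))
               ≡⟨ Words-cong k xs (λ w → trans
                    (cong (_* f (x ∷ w)) (𝟙-∧ (does (All.all? (λ y → ¬? (x ≈? y)) w)) _))
                    (*-assoc (fresh x w) _ _)) ⟩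
             Words k xs (λ w → fresh x w * (𝟙 (does (unique? w)) * f (x ∷ w)))
               ≡⟨ Words-fresh k x xs r rem _ ⟩
             Words k r (λ w → 𝟙 (does (unique? w)) * f (x ∷ w))
               ≡⟨ Words-unique k r ur (λ w → f (x ∷ w)) ⟩
             Arr k r (λ w → f (x ∷ w)) ∎) ⟩
      Arr (suc k) xs f ∎

  -- Peak sets as bit patterns

  ones : ℕ → List Bool → List ℕ
  ones k []           = []
  ones k (true ∷ bs)  = k ∷ ones (suc k) bs
  ones k (false ∷ bs) = ones (suc k) bs

  ones-if : ∀ k b bs → ones k (b ∷ bs) ≡ (if b then k ∷ [] else []) ++ ones (suc k) bs
  ones-if k true  bs = refl
  ones-if k false bs = refl

  asc-flip : ∀ {a c} → a ≢ c → asc c a ≡ not (asc a c)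
  asc-flip {a} {c} a≢c with a <? c
  ... | yes a<c = asc-no (<⇒≯ a<c)
  ... | no  a≮c = asc-yes (≤∧≢⇒< (≮⇒≥ a≮c) (a≢c ∘ sym))

  -- One side tests c < b, the other the failure of b < c; distinct letters make these agree. The
  -- letter a survives only as the state.
  peaksFrom-ones : ∀ k a b w → Unique (a ∷ b ∷ w) →
    peaksFrom k (a ∷ b ∷ w) ≡ ones (suc k) (pat (asc a b) (b ∷ w))
  peaksFrom-ones k a b []      u = refl
  peaksFrom-ones k a b (c ∷ r) (_ ∷ u@((b≢c ∷ _) ∷ _)) = begin
    (if asc a b ∧ asc c b then suc k ∷ [] else []) ++ peaksFrom (suc k) (b ∷ c ∷ r)
      ≡⟨ cong₂ (λ d l → (if asc a b ∧ d then suc k ∷ [] else []) ++ l) (asc-flip b≢c) (peaksFrom-ones (suc k) b c r u) ⟩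
    (if asc a b ∧ not (asc b c) then suc k ∷ [] else []) ++ ones (suc (suc k)) (pat (asc b c) (c ∷ r))
      ≡⟨ sym (ones-if (suc k) (asc a b ∧ not (asc b c)) _) ⟩
    ones (suc k) (pat (asc a b) (b ∷ c ∷ r)) ∎

  peaks-ones : ∀ w → Unique w → peaks w ≡ ones 1 (pat false w)
  peaks-ones []          u = refl
  peaks-ones (a ∷ [])    u = refl
  peaks-ones (a ∷ b ∷ w) u = peaksFrom-ones 1 a b w u

  ones-≥ : ∀ k bs → All (k ≤_) (ones k bs)
  ones-≥ k []           = []
  ones-≥ k (true ∷ bs)  = ≤-refl ∷ All.map (≤-trans (n≤1+n k)) (ones-≥ (suc k) bs)
  ones-≥ k (false ∷ bs) = All.map (≤-trans (n≤1+n k)) (ones-≥ (suc k) bs)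

  ones-< : ∀ k bs → All (_< k + length bs) (ones k bs)
  ones-< k []       = []
  ones-< k (b ∷ bs) = subst (λ n → All (_< n) (ones k (b ∷ bs))) (sym (+-suc k (length bs))) (go b)
    where
    go : ∀ b → All (_< suc (k + length bs)) (ones k (b ∷ bs))
    go true  = s≤s (m≤m+n k (length bs)) ∷ ones-< (suc k) bs
    go false = ones-< (suc k) bs

  ones-∉ : ∀ k bs → k ∉ ones (suc k) bs
  ones-∉ k bs k∈ = 1+n≰n (All.lookup (ones-≥ (suc k) bs) k∈)

  ones-tail : ∀ {k b c bs cs} → ones k (b ∷ bs) ⊆ ones k (c ∷ cs) → ones (suc k) bs ⊆ ones (suc k) cs
  ones-tail {k} {b} {c} {bs} {cs} sub {x} x∈ = strip c (sub (weaken b x∈))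
    where
    weaken : ∀ b → x ∈ ones (suc k) bs → x ∈ ones k (b ∷ bs)
    weaken true  p = there p
    weaken false p = p
    strip : ∀ c → x ∈ ones k (c ∷ cs) → x ∈ ones (suc k) cs
    strip true  (here refl) = contradiction x∈ (ones-∉ k bs)
    strip true  (there p)   = p
    strip false p           = p

  -- Whether k belongs to the set decides the first bit, since all later positions exceed k. Equal
  -- lengths matter because trailing zeros leave no trace in the set.
  ones-injective : ∀ k bs cs → length bs ≡ length cs →
    ones k bs ⊆ ones k cs → ones k cs ⊆ ones k bs → bs ≡ cs
  ones-injective k []       []       l p q = refl
  ones-injective k (b ∷ bs) (c ∷ cs) l p q = cong₂ _∷_ (bit b c p q)
    (ones-injective (suc k) bs cs (suc-injective l) (ones-tail {b = b} {c} p) (ones-tail {b = c} {b} q))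
    where
    bit : ∀ b c → ones k (b ∷ bs) ⊆ ones k (c ∷ cs) → ones k (c ∷ cs) ⊆ ones k (b ∷ bs) → b ≡ c
    bit true  true  p q = refl
    bit false false p q = refl
    bit true  false p q = contradiction (p (here refl)) (ones-∉ k cs)
    bit false true  p q = contradiction (q (here refl)) (ones-∉ k bs)

  𝟙-does-δ : ∀ {X : Set} {bs cs} (d : Dec X) → (X → bs ≡ cs) → (bs ≡ cs → X) → 𝟙 (does d) ≡ δ bs cs
  𝟙-does-δ {bs = bs} (yes x) f g with f x
  ... | refl = sym (δ-refl bs)
  𝟙-does-δ {bs = bs} {cs} (no ¬x) f g = sym (δ-≢ bs cs (¬x ∘ g))

  length-map-toList : ∀ {n k} (v : Vec (Fin n) k) → length (map toℕ (toList v)) ≡ k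
  length-map-toList []      = refl
  length-map-toList (x ∷ v) = cong suc (length-map-toList v)

  module _ {S : List ℕ} {P : List Bool} (to : S ⊆ ones 1 P) (from : ones 1 P ⊆ S) where

    peakSet-δ : ∀ w → Unique w → length w ≡ length P →
      𝟙 (does ((peaks w ⊆? S) ×-dec (S ⊆? peaks w))) ≡ δ (pat false w) P
    peakSet-δ w u l = 𝟙-does-δ ((peaks w ⊆? S) ×-dec (S ⊆? peaks w))
      (λ { (p , q) → ones-injective 1 (pat false w) P (trans (length-pat false w) l)
        (λ x∈ → to (p (subst (_ ∈_) (sym (peaks-ones w u)) x∈)))
        (λ x∈ → subst (_ ∈_) (peaks-ones w u) (q (from x∈))) })
      (λ e →
        (λ x∈ → from (subst (λ bs → _ ∈ ones 1 bs) e (subst (_ ∈_) (peaks-ones w u) x∈))) ,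
        (λ x∈ → subst (_ ∈_) (sym (peaks-ones w u)) (subst (λ bs → _ ∈ ones 1 bs) (sym e) (to x∈))))

    countP-N : ∀ n → length P ≡ n → countP S n ≡ N P
    countP-N n l = begin
      length (filter (inP n S) (allWords n n))
        ≡⟨ length-filter-sum (inP n S) (allWords n n) ⟩
      sumOver (allWords n n) (λ v → 𝟙 (does (inP n S v)))
        ≡⟨ sumOver-cong (allWords n n) pointwise ⟩
      sumOver (allWords n n) ((λ w → 𝟙 (does (unique? w)) * δ (pat false (map toℕ w)) P) ∘ toList)
        ≡⟨ allWords-sum n n _ ⟩
      Words n (allFin n) (λ w → 𝟙 (does (unique? w)) * δ (pat false (map toℕ w)) P)
        ≡⟨ Words-unique Fin._≟_ n (allFin n) (allFin⁺ n) _ ⟩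
      Arr n (allFin n) (λ w → δ (pat false (map toℕ w)) P)
        ≡⟨ sym (Arr-map n toℕ (allFin n) _) ⟩
      Arr n (map toℕ (allFin n)) (λ w → δ (pat false w) P)
        ≡⟨ cong (λ xs → Arr n xs (λ w → δ (pat false w) P)) (trans (map-tabulate id toℕ) (tabulate-toℕ n id)) ⟩
      Perm n (λ w → δ (pat false w) P)
        ≡⟨ cong (λ k → Perm k (λ w → δ (pat false w) P)) (sym l) ⟩
      N P ∎
      where
      open UDec (Fin._≟_ {n}) using (unique?)
      tabulate-toℕ : ∀ n (f : ℕ → ℕ) → tabulate (λ (i : Fin n) → f (toℕ i)) ≡ applyUpTo f n
      tabulate-toℕ zero    f = refl
      tabulate-toℕ (suc n) f = cong (f 0 ∷_) (tabulate-toℕ n (f ∘ suc))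
      pointwise : ∀ v → 𝟙 (does (inP n S v)) ≡
        𝟙 (does (unique? (toList v))) * δ (pat false (map toℕ (toList v))) P
      pointwise v with unique? (toList v)
      ... | no _  = refl
      ... | yes u = trans (peakSet-δ (map toℕ (toList v)) (map⁺ Fin.toℕ-injective u)
              (trans (length-map-toList v) (sym l))) (sym (+-identityʳ _))

  does-true : ∀ {X : Set} (d : Dec X) → does d ≡ true → X
  does-true (yes x) _ = x

  -- A nonzero count provides an actual permutation, and its peaks lie inside it. This yields i_a ≥
  -- 1 and, for t = 0, also i_s ≤ n.
  countP-bounds : ∀ S n → countP S n ≢ 0 → ∀ {x} → x ∈ S → 1 ≤ x × x ≤ n
  countP-bounds S n c≢0 {x} x∈ = go (allWords n n) c≢0
    where
    bounds : ∀ v → does (inP n S v) ≡ true → 1 ≤ x × x ≤ n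
    bounds v e =
      All.lookup (ones-≥ 1 bs) x∈bs ,
      s≤s⁻¹ (subst (λ k → x < suc k) (trans (length-pat false w) (length-map-toList v)) (All.lookup (ones-< 1 bs) x∈bs))
      where
      v∈P = does-true (inP n S v) e
      w = map toℕ (toList v)
      bs = pat false w
      x∈bs : x ∈ ones 1 bs
      x∈bs = subst (x ∈_) (peaks-ones w (map⁺ Fin.toℕ-injective (proj₁ v∈P))) (proj₂ (proj₂ v∈P) x∈)
    go : ∀ vs → length (filter (inP n S) vs) ≢ 0 → 1 ≤ x × x ≤ n
    go []       ne = ⊥-elim (ne refl)
    go (v ∷ vs) ne with does (inP n S v) in e
    ... | true  = bounds v e
    ... | false = go vs ne

  -- The positions of the true bits of a pattern, counted from its end, starting with 0.
  idx : List Bool → List ℕ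
  idx []           = []
  idx (true ∷ bs)  = length bs ∷ idx bs
  idx (false ∷ bs) = idx bs

  -- The pattern grows from its end: `acc` is the finished part, of length l, and zeros fill it up
  -- to length a, so that the new 1 has index a from the end.
  build : ℕ → List Bool → List ℕ → List Bool
  build l acc []       = acc
  build l acc (a ∷ as) = build (suc a) (true ∷ zeros (a ∸ l) acc) as

  idx-zeros : ∀ m bs → idx (zeros m bs) ≡ idx bs
  idx-zeros zero    bs = refl
  idx-zeros (suc m) bs = idx-zeros m bs

  ♯-zeros : ∀ m bs → ♯ (zeros m bs) ≡ ♯ bs
  ♯-zeros zero    bs = refl
  ♯-zeros (suc m) bs = ♯-zeros m bs

  length-zeros : ∀ m bs → length (zeros m bs) ≡ m + length bs
  length-zeros zero    bs = refl
  length-zeros (suc m) bs = cong suc (length-zeros m bs)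

  length-zeros-∸ : ∀ {l a acc} → length acc ≡ l → l ≤ a → length (zeros (a ∸ l) acc) ≡ a
  length-zeros-∸ {l} {a} {acc} e l≤a =
    trans (length-zeros (a ∸ l) acc) (trans (cong (a ∸ l +_) e) (m∸n+n≡m l≤a))

  idx-build : ∀ {l acc as} → length acc ≡ l → Inc l as → idx (build l acc as) ≡ as ʳ++ idx acc
  idx-build e []       = refl
  idx-build {l} {acc} {a ∷ as} e (p ∷ ps) = trans (idx-build (cong suc (length-zeros-∸ {acc = acc} e p)) ps)
    (cong₂ (λ x xs → as ʳ++ x ∷ xs) (length-zeros-∸ {acc = acc} e p) (idx-zeros (a ∸ l) acc))

  ♯-build : ∀ l acc as → ♯ (build l acc as) ≡ length as + ♯ acc
  ♯-build l acc []       = refl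
  ♯-build l acc (a ∷ as) = trans (♯-build (suc a) _ as)
    (trans (+-suc (length as) _) (cong (λ c → suc (length as + c)) (♯-zeros (a ∸ l) acc)))

  -- With no zeros in front, the length of the pattern is governed by its outermost 1 and hence
  -- gives the exact degree.
  data Top : List Bool → Set where
    none : Top []
    true : ∀ bs → Top (true ∷ bs)

  Top-build : ∀ l acc as → Top acc → Top (build l acc as)
  Top-build l acc []       t = t
  Top-build l acc (a ∷ as) t = Top-build (suc a) _ as (true (zeros (a ∸ l) acc))

  ones-ʳ++ : ∀ R Z → ones 1 (R ʳ++ Z) ≡ map suc (idx R) ʳ++ ones (suc (length R)) Z
  ones-ʳ++ []          Z = refl
  ones-ʳ++ (true ∷ R)  Z = ones-ʳ++ R (true ∷ Z)
  ones-ʳ++ (false ∷ R) Z = ones-ʳ++ R (false ∷ Z)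

  ones-zeros : ∀ k m bs → ones k (zeros m bs) ≡ ones (k + m) bs
  ones-zeros k zero    bs = cong (λ j → ones j bs) (sym (+-identityʳ k))
  ones-zeros k (suc m) bs = trans (ones-zeros (suc k) m bs) (cong (λ j → ones j bs) (sym (+-suc k m)))

  -- Positions from the left start at 1 and indices from the right at 0, which is why the sum is
  -- `suc n`.
  ones-idx : ∀ k bs n → k + length bs ≡ suc n → ones k bs ≡ map (n ∸_) (idx bs)
  ones-idx k []           n e = refl
  ones-idx k (true ∷ bs)  n e = cong₂ _∷_
    (sym (trans (cong (_∸ length bs) (suc-injective (trans (sym e) (+-suc k (length bs))))) (m+n∸n≡m k (length bs))))
    (ones-idx (suc k) bs n (trans (sym (+-suc k (length bs))) e))
  ones-idx k (false ∷ bs) n e = ones-idx (suc k) bs n (trans (sym (+-suc k (length bs))) e)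

  StrictInc⇒Inc : ∀ {t} (j : Fin t → ℕ) l → StrictInc j → (∀ b → l ≤ j b) → Inc l (tabulate j)
  StrictInc⇒Inc {zero}  j l inc lb = []
  StrictInc⇒Inc {suc t} j l inc lb = lb Fin.zero ∷
    StrictInc⇒Inc (j ∘ Fin.suc) (suc (j Fin.zero)) (λ a b a<b → inc (Fin.suc a) (Fin.suc b) (s≤s a<b))
      (λ b → inc Fin.zero (Fin.suc b) (s≤s z≤n))

  bits : ∀ {t} → (Fin t → ℕ) → List Bool
  bits j = build 0 [] (tabulate j)

  length-build : ∀ {t} (j : Fin (suc t) → ℕ) l acc → length acc ≡ l → Inc l (tabulate j) →
    length (build l acc (tabulate j)) ≡ suc (j (fromℕ t))
  length-build {zero}  j l acc e (p ∷ ps) = cong suc (length-zeros-∸ {acc = acc} e p)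
  length-build {suc t} j l acc e (p ∷ ps) =
    length-build (j ∘ Fin.suc) (suc (j Fin.zero)) _ (cong suc (length-zeros-∸ {acc = acc} e p)) ps

  length-bits : ∀ {t} (j : Fin (suc t) → ℕ) → StrictInc j → length (bits j) ≡ suc (j (fromℕ t))
  length-bits j inc = length-build j 0 [] refl (StrictInc⇒Inc j 0 inc λ _ → z≤n)

  ♯-bits : ∀ {t} (j : Fin t → ℕ) → ♯ (bits j) ≡ t
  ♯-bits j = trans (♯-build 0 [] (tabulate j)) (trans (+-identityʳ _) (length-tabulate j))

  -- i⁻ is i shifted down by one: the position i_a is the (i_a - 1)-st bit from the start.
  module _ {s t : ℕ} (i⁻ : Fin s → ℕ) (j : Fin t → ℕ) (inc-i : StrictInc i⁻) (inc-j : StrictInc j)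
    (i : Fin s → ℕ) (i≡ : ∀ a → suc (i⁻ a) ≡ i a) where

    private
      R = bits i⁻
      Y = bits j
      I : List ℕ
      I = tabulate i⁻

      map-suc-I : map suc I ≡ tabulate i
      map-suc-I = trans (map-tabulate i⁻ suc) (tabulate-cong i≡)

      idx-R : idx R ≡ I ʳ++ []
      idx-R = idx-build refl (StrictInc⇒Inc i⁻ 0 inc-i λ _ → z≤n)

      idx-Y : idx Y ≡ tabulate j ʳ++ []
      idx-Y = idx-build refl (StrictInc⇒Inc j 0 inc-j λ _ → z≤n)

    module _ (n m : ℕ) (size : length R + (m + length Y) ≡ n) where

      private
        P = R ʳ++ zeros m Y

        ones-P : ones 1 P ≡ map suc (I ʳ++ []) ʳ++ map (n ∸_) (tabulate j ʳ++ [])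
        ones-P = begin
          ones 1 P
            ≡⟨ ones-ʳ++ R (zeros m Y) ⟩
          map suc (idx R) ʳ++ ones (suc (length R)) (zeros m Y)
            ≡⟨ cong₂ (λ x y → map suc x ʳ++ y) idx-R (trans (ones-zeros (suc (length R)) m Y)
                 (trans (ones-idx (suc (length R) + m) Y n (cong suc (trans (+-assoc (length R) m _) size)))
                   (cong (map (n ∸_)) idx-Y))) ⟩
          map suc (I ʳ++ []) ʳ++ map (n ∸_) (tabulate j ʳ++ []) ∎

        -- The indices come in reversed order; peak sets are compared by inclusion, so membership is
        -- all that has to be carried across.
        map-ʳ-∈⁺ : ∀ {f : ℕ → ℕ} xs {y} → y ∈ map f xs → y ∈ map f (xs ʳ++ [])
        map-ʳ-∈⁺ {f} xs y∈ with ∈-map⁻ f y∈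
        ... | x , x∈ , refl = ∈-map⁺ f (reverseAcc⁺ [] xs (inj₂ x∈))

        map-ʳ-∈⁻ : ∀ {f : ℕ → ℕ} xs {y} → y ∈ map f (xs ʳ++ []) → y ∈ map f xs
        map-ʳ-∈⁻ {f} xs y∈ with ∈-map⁻ f y∈
        ... | x , x∈ , refl with reverseAcc⁻ [] xs x∈
        ...   | inj₂ x∈′ = ∈-map⁺ f x∈′

        J≡ : map (n ∸_) (tabulate j) ≡ tabulate (λ b → n ∸ j b)
        J≡ = map-tabulate j (n ∸_)

        to : Sn s t i j n ⊆ ones 1 P
        to {x} x∈ = subst (x ∈_) (sym ones-P)
          (reverseAcc⁺ (map (n ∸_) (tabulate j ʳ++ [])) (map suc (I ʳ++ [])) (side (∈-++⁻ (tabulate i) x∈)))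
          where
          side : x ∈ tabulate i ⊎ x ∈ tabulate (λ b → n ∸ j b) →
            x ∈ map (n ∸_) (tabulate j ʳ++ []) ⊎ x ∈ map suc (I ʳ++ [])
          side (inj₁ p) = inj₂ (map-ʳ-∈⁺ I (subst (x ∈_) (sym map-suc-I) p))
          side (inj₂ p) = inj₁ (map-ʳ-∈⁺ (tabulate j) (subst (x ∈_) (sym J≡) p))

        from : ones 1 P ⊆ Sn s t i j n
        from {x} x∈ with reverseAcc⁻ (map (n ∸_) (tabulate j ʳ++ [])) (map suc (I ʳ++ [])) (subst (x ∈_) ones-P x∈)
        ... | inj₁ p = ∈-++⁺ʳ (tabulate i) (subst (x ∈_) J≡ (map-ʳ-∈⁻ (tabulate j) p))
        ... | inj₂ p = ∈-++⁺ˡ (subst (x ∈_) map-suc-I (map-ʳ-∈⁻ I p))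

      countP-pattern : countP (Sn s t i j n) n ≡ N P
      countP-pattern = countP-N {P = P} to from n (trans (length-ʳ++ R) (trans (cong (length R +_) (length-zeros m Y)) size))


-- The sets S_n and the theorem

open import Defs
open PeakPatterns
open NewtonCoefficients hiding (Σ)
open NewtonPolynomials
open PermutationPatterns
open import Data.Nat as ℕ using (ℕ; zero; suc; _+_; _∸_; _^_; _≤_; _<_; z≤n; s≤s)
import Data.Nat.Properties as ℕ
open import Data.Integer as ℤ using (ℤ; 0ℤ)
import Data.Integer.Properties as ℤ
open import Data.Fin using (Fin; fromℕ)
open import Data.Rational using (ℚ; 0ℚ; _*_)
open import Data.Bool using (true; false)
open import Data.List using (List; []; _∷_; _ʳ++_; length; reverse; tabulate)
open import Data.List.Properties using (length-ʳ++; ʳ++-defn)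
open import Data.List.Membership.Propositional.Properties using (∈-++⁺ˡ; ∈-tabulate⁺)
open import Data.Product using (Σ; ∃-syntax; _×_; _,_; proj₁; proj₂)
open import Relation.Nullary using (contradiction)
open import Relation.Binary.PropositionalEquality

♯≤length : ∀ bs → ♯ bs ≤ length bs
♯≤length []           = z≤n
♯≤length (true ∷ bs)  = s≤s (♯≤length bs)
♯≤length (false ∷ bs) = ℕ.m≤n⇒m≤1+n (♯≤length bs)

-- Without a zero in between, a 1 would stand at an end of the pattern or beside another 1, and such
-- patterns have count zero.
no-gap : ∀ {R Y} → Top R → Top Y → N (R ʳ++ zeros 0 Y) ≢ 0 → R ≡ [] × Y ≡ []
no-gap none     none     adm = refl , refl
no-gap none     (true y) adm = contradiction (N-start-true y) adm
no-gap (true R) none     adm = contradiction (trans (cong N (ʳ++-defn R)) (N-end-true (reverse R))) adm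
no-gap (true R) (true y) adm = contradiction (trans (cong N (ʳ++-defn R)) (N-adjacent (reverse R) y)) adm

right-lead : ∀ {Y} → Top Y → ∀ m → N (zeros (suc m) Y) ≢ 0 → right Y (length Y ∸ 1) ≢ 0ℤ
right-lead none     m adm ()
right-lead (true y) m adm = right₁-lead y m adm

left-lead : ∀ {R Y} → Top R → Top Y → ∀ m → N (R ʳ++ zeros m Y) ≢ 0 →
  left R Y ((length R ∸ 1) + (length Y ∸ 1)) ≢ 0ℤ
left-lead tR tY zero adm with no-gap tR tY adm
... | refl , refl = λ ()
left-lead none     none     (suc m) adm = λ ()
left-lead none     (true y) (suc m) adm = right₁-lead y m adm
left-lead (true R) tY       (suc m) adm = left₁-lead R _ m adm (right-lead tY)

lowered-inc : ∀ {s} {i : Fin s → ℕ} → StrictInc i → (∀ a → 1 ≤ i a) → StrictInc (λ a → i a ∸ 1)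
lowered-inc inc i≥1 a b a<b = ℕ.∸-monoˡ-< (inc a b a<b) (i≥1 a)

length-bits-lowered : ∀ {s} (i : Fin (suc s) → ℕ) → StrictInc i → (∀ a → 1 ≤ i a) →
  length (bits (λ a → i a ∸ 1)) ≡ i (fromℕ s)
length-bits-lowered i inc i≥1 =
  trans (length-bits (λ a → i a ∸ 1) (lowered-inc inc i≥1)) (ℕ.m+[n∸m]≡n (i≥1 _))

-- For t > 0 the bound is the displayed chain of inequalities. For t = 0 that chain does not mention
-- n, and i_s ≤ n is read off from an actual peak.
bits-fit : ∀ {s t} (i : Fin s → ℕ) (j : Fin t → ℕ) → StrictInc i → StrictInc j → (∀ a → 1 ≤ i a) →
  ∀ n → ValidN s t i j n → countP (Sn s t i j n) n ≢ 0 →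
  length (bits (λ a → i a ∸ 1)) + length (bits j) ≤ n
bits-fit {zero}  {zero}  i j ii ij i≥1 n valid c≢0 = z≤n
bits-fit {zero}  {suc t} i j ii ij i≥1 n valid c≢0 =
  subst (_≤ n) (sym (length-bits j ij)) (proj₁ valid (fromℕ t))
bits-fit {suc s} {zero}  i j ii ij i≥1 n valid c≢0 =
  subst (_≤ n) (sym (trans (ℕ.+-identityʳ _) (length-bits-lowered i ii i≥1)))
    (proj₂ (countP-bounds _ n c≢0 (∈-++⁺ˡ (∈-tabulate⁺ {f = i} (fromℕ s)))))
bits-fit {suc s} {suc t} i j ii ij i≥1 n valid c≢0 =
  subst (_≤ n) (sym (trans (cong₂ _+_ (length-bits-lowered i ii i≥1) (length-bits j ij)) (ℕ.+-suc _ _)))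
    (proj₂ valid (fromℕ s) (fromℕ t))

-- The left pattern has length i_s but the right one j_t + 1, as offsets from the right start at 0.
-- Hence the 1 is subtracted only when s > 0.
degree-formula : ∀ s t (i : Fin s → ℕ) (j : Fin t → ℕ) → StrictInc i → StrictInc j → (∀ a → 1 ≤ i a) →
  (length (bits (λ a → i a ∸ 1)) ∸ 1) + (length (bits j) ∸ 1) ≡ degFormula s t i j
degree-formula zero    zero    i j ii ij i≥1 = refl
degree-formula (suc s) zero    i j ii ij i≥1 =
  trans (ℕ.+-identityʳ _) (cong (_∸ 1) (length-bits-lowered i ii i≥1))
degree-formula zero    (suc t) i j ii ij i≥1 = cong (_∸ 1) (length-bits j ij)
degree-formula (suc s) (suc t) i j ii ij i≥1 = trans
  (cong₂ (λ x y → (x ∸ 1) + (y ∸ 1)) (length-bits-lowered i ii i≥1) (length-bits j ij))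
  (sym (ℕ.+-∸-comm (j (fromℕ t)) (i≥1 (fromℕ s))))

module _ {s t : ℕ} {i : Fin s → ℕ} {j : Fin t → ℕ} (inc-i : StrictInc i) (inc-j : StrictInc j)
  (i≥1 : ∀ a → 1 ≤ i a) where

  private
    i⁻ : Fin s → ℕ
    i⁻ a = i a ∸ 1

    suc-i⁻ : ∀ a → suc (i⁻ a) ≡ i a
    suc-i⁻ a = ℕ.m+[n∸m]≡n (i≥1 a)

    inc-i⁻ : StrictInc i⁻
    inc-i⁻ = lowered-inc inc-i i≥1

    R = bits i⁻
    Y = bits j

  coeffs : ℕ → ℤ
  coeffs = left R Y

  degree : ℕ
  degree = (length R ∸ 1) + (length Y ∸ 1)

  coeffs-vanish : ∀ r → degree < r → coeffs r ≡ 0ℤ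
  coeffs-vanish = left-deg R Y

  private
    tR : Top R
    tR = Top-build 0 [] (tabulate i⁻) none
    tY : Top Y
    tY = Top-build 0 [] (tabulate j) none

    fits : ∀ n → ValidN s t i j n → countP (Sn s t i j n) n ≢ 0 → length R + length Y ≤ n
    fits n valid c≢0 = bits-fit i j inc-i inc-j i≥1 n valid c≢0

    parametrise : ∀ n → ValidN s t i j n → countP (Sn s t i j n) n ≢ 0 →
      ∃[ m ] (length R + (m + length Y) ≡ n × countP (Sn s t i j n) n ≡ N (R ʳ++ zeros m Y))
    parametrise n valid c≢0 = m , size , countP-pattern i⁻ j inc-i⁻ inc-j i suc-i⁻ n m size
      where
      m = n ∸ (length R + length Y)
      size : length R + (m + length Y) ≡ n
      size = trans (cong (length R +_) (ℕ.+-comm m (length Y)))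
        (trans (sym (ℕ.+-assoc (length R) (length Y) m)) (ℕ.m+[n∸m]≡n (fits n valid c≢0)))

  coeffs-lead : ∀ n → ValidN s t i j n → countP (Sn s t i j n) n ≢ 0 → coeffs degree ≢ 0ℤ
  coeffs-lead n valid c≢0 with parametrise n valid c≢0
  ... | m , _ , c≡N = left-lead tR tY m (λ e → c≢0 (trans c≡N e))

  countP-val : ∀ n → ValidN s t i j n → countP (Sn s t i j n) n ≢ 0 →
    ℤ.+ countP (Sn s t i j n) n ≡ val coeffs n ℤ.* ℤ.+ (2 ^ (n ∸ (s + t) ∸ 1))
  countP-val n valid c≢0 with parametrise n valid c≢0
  ... | zero  , size , c≡N = trans (cong ℤ.+_ c≡N) (empty n size (no-gap tR tY (λ e → c≢0 (trans c≡N e))))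
    where
    -- The empty permutation: n - #S - 1 would be negative, and truncation makes the power 1, in
    -- agreement with the count 1.
    empty : ∀ {R Y} n → length R + (0 + length Y) ≡ n → R ≡ [] × Y ≡ [] →
      ℤ.+ N (R ʳ++ zeros 0 Y) ≡ val (left R Y) n ℤ.* ℤ.+ (2 ^ (n ∸ (s + t) ∸ 1))
    empty .0 refl (refl , refl) = cong (λ e → ℤ.1ℤ ℤ.* ℤ.+ (2 ^ (e ∸ 1))) (sym (ℕ.0∸n≡0 (s + t)))
  ... | suc m , size , c≡N = ℤ.*-cancelʳ-≡ _ _ (ℤ.+ (2 ^ suc c)) {{nonzero}} (begin
      ℤ.+ countP (Sn s t i j n) n ℤ.* ℤ.+ (2 ^ suc c)
        ≡⟨ cong₂ (λ x y → ℤ.+ x ℤ.* ℤ.+ (2 ^ suc y)) c≡N (sym (cong₂ _+_ (♯-bits i⁻) (♯-bits j))) ⟩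
      ℤ.+ N P ℤ.* ℤ.+ (2 ^ suc (♯ R + ♯ Y))
        ≡⟨ CountedBy.equation (left-counts R Y m) ⟩
      val coeffs (length P) ℤ.* ℤ.+ (2 ^ length P)
        ≡⟨ cong (λ k → val coeffs k ℤ.* ℤ.+ (2 ^ k)) length-P ⟩
      val coeffs n ℤ.* ℤ.+ (2 ^ n)
        ≡⟨ cong (λ k → val coeffs n ℤ.* ℤ.+ (2 ^ k)) (sym exponent) ⟩
      val coeffs n ℤ.* ℤ.+ (2 ^ (n ∸ c ∸ 1 + suc c))
        ≡⟨ cong (val coeffs n ℤ.*_) (pos-2^+ (n ∸ c ∸ 1) (suc c)) ⟩
      val coeffs n ℤ.* (ℤ.+ (2 ^ (n ∸ c ∸ 1)) ℤ.* ℤ.+ (2 ^ suc c))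
        ≡⟨ sym (ℤ.*-assoc (val coeffs n) _ _) ⟩
      val coeffs n ℤ.* ℤ.+ (2 ^ (n ∸ c ∸ 1)) ℤ.* ℤ.+ (2 ^ suc c) ∎)
    where
    open ≡-Reasoning
    c = s + t
    P = R ʳ++ zeros (suc m) Y
    nonzero : ℤ.NonZero (ℤ.+ (2 ^ suc c))
    nonzero = ℤ.≢-nonZero λ e → ℕ.≢-nonZero⁻¹ (2 ^ suc c) {{ℕ.m^n≢0 2 (suc c)}} (ℤ.+-injective e)
    length-P : length P ≡ n
    length-P = trans (length-ʳ++ R) (trans (cong (length R +_) (length-zeros (suc m) Y)) size)
    -- The gap holds at least one zero, so the bits outnumber the peaks and the exponent n - c - 1
    -- is not truncated.
    c<n : c < n
    c<n = subst₂ _≤_ (trans (ℕ.+-suc (♯ R) (♯ Y)) (cong suc (cong₂ _+_ (♯-bits i⁻) (♯-bits j)))) size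
      (ℕ.+-mono-≤ (♯≤length R) (s≤s (ℕ.≤-trans (♯≤length Y) (ℕ.m≤n+m (length Y) m))))
    exponent : n ∸ c ∸ 1 + suc c ≡ n
    exponent = trans (cong (_+ suc c) (trans (ℕ.∸-+-assoc n c 1) (cong (n ∸_) (ℕ.+-comm c 1)))) (ℕ.m∸n+n≡m c<n)

theorem4p1 : (s t : ℕ) (i : Fin s → ℕ) (j : Fin t → ℕ) → StrictInc i → StrictInc j →
    (∃[ n ] (ValidN s t i j n × countP (Sn s t i j n) n ≢ 0)) →
    ∃[ d ] Σ (Fin (suc d) → ℚ) λ p →
    (p (fromℕ d) ≢ 0ℚ)
    × IntegerValued p
    × ((n : ℕ) → ValidN s t i j n → countP (Sn s t i j n) n ≢ 0 →
    ℕtoℚ (countP (Sn s t i j n) n) ≡ evalPoly p (ℕtoℚ n) * ℕtoℚ (2 ^ (n ∸ (s + t) ∸ 1)))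
    × d ≡ degFormula s t i j
theorem4p1 s t i j inc-i inc-j (n₀ , valid₀ , c₀≢0) =
  d , newton a 0 d ,
  newton-last a 0 d (coeffs-lead inc-i inc-j i≥1 n₀ valid₀ c₀≢0) ,
  newton-integerValued a d ,
  (λ n valid c≢0 → trans (cong ℤtoℚ (countP-val inc-i inc-j i≥1 n valid c≢0))
    (trans (ℤtoℚ-* (val a n) _)
      (cong (_* ℕtoℚ (2 ^ (n ∸ (s + t) ∸ 1))) (sym (newton-val a d (coeffs-vanish inc-i inc-j i≥1) n))))) ,
  degree-formula s t i j inc-i inc-j i≥1
  where
  -- Position 0 is never a peak, so a single admissible n₀ already excludes it from the constants
  -- i_a.
  i≥1 : ∀ a → 1 ≤ i a
  i≥1 a = proj₁ (countP-bounds _ n₀ c₀≢0 (∈-++⁺ˡ (∈-tabulate⁺ {f = i} a)))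
  a = coeffs inc-i inc-j i≥1
  d = degree inc-i inc-j i≥1
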